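{- Let $p$ be a prime and $n$ a positive integer, with $n$ sufficiently large and $n^{6}\le p\le n^{C}$ for a fixed constant $C$. For every $n$-element set $X\subset[p]$, the expected maxload of $\mathsf{2LH}$ on $X$ is at most $n/2+\widetilde{\mathcal{O}}(\sqrt{n})$ (i.e. $n/2+\sqrt{n}\,(\log n)^{\mathcal{O}(1)}$).
   Context: $[N]=\{0,\dots,N-1\}$; $\mathfrak{m}_p(x)$ is the unique element of $(x+p\mathbb{Z})\cap[0,p)$. Multiplicative two-bin linear hashing $\mathsf{2LH}$: choose $a$ uniformly from $\{1,\dots,p-1\}$ and place $x\in[p]$ in bin $\lfloor \mathfrak{m}_p(ax)/(p/2)\rfloor\in\{0,1\}$. The maxload on $X$ is the number of elements of $X$ in the fuller of the two bins. -}

module Defs where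

open import Data.Nat using (ℕ; zero; suc; _+_; _*_; _∸_; _<_; _<ᵇ_; NonZero; _⊔_)
open import Data.Nat.DivMod using (_%_)
open import Data.Bool using (Bool; true; false; if_then_else_)
open import Data.List using (List; []; _∷_; map; applyUpTo; length)
open import Data.Nat.ListAction using (sum)

modp : (p : ℕ) .{{_ : NonZero p}} → ℕ → ℕ
modp p y = y % p

-- bin of x under multiplier a: ⌊ 𝔪_p(a x) / (p/2) ⌋ ∈ {0,1};
-- it is 0 iff 𝔪_p(a x) < p/2 iff 2 * 𝔪_p(a x) < p.  Returns true for bin 0.
inBin0 : (p : ℕ) .{{_ : NonZero p}} → (a x : ℕ) → Bool
inBin0 p a x = (2 * modp p (a * x)) <ᵇ p

count : {A : Set} → (A → Bool) → List A → ℕ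
count f [] = 0
count f (y ∷ ys) = (if f y then 1 else 0) + count f ys

load0 : (p : ℕ) .{{_ : NonZero p}} → ℕ → List ℕ → ℕ
load0 p a X = count (inBin0 p a) X

load1 : (p : ℕ) .{{_ : NonZero p}} → ℕ → List ℕ → ℕ
load1 p a X = count (λ x → if inBin0 p a x then false else true) X

maxload : (p : ℕ) .{{_ : NonZero p}} → ℕ → List ℕ → ℕ
maxload p a X = load0 p a X ⊔ load1 p a X

-- Σ_{a=1}^{p-1} maxload(a); the expected maxload is this divided by (p - 1)
totalMaxload : (p : ℕ) .{{_ : NonZero p}} → List ℕ → ℕ
totalMaxload p X = sum (applyUpTo (λ i → maxload p (suc i) X) (p ∸ 1))

{-# OPTIONS --safe #-}
module Submission where

-- Let D(a) be the difference of the two loads.  The excess is Σ_a |D(a)|, so by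
-- Cauchy-Schwarz it suffices that Σ_a D(a)² ≤ n p (log p)^O(1).  The sign of a bin is a
-- combination of two sawtooths, p · sign(t) = saw(2t) - 2 saw(t), and doubling permutes
-- the multipliers, so D may be replaced by E(a) = Σ_{x ∈ X} saw(a x).  Expanding the
-- square, Σ_a E(a)² is a sum over pairs (x , y) of correlations, and the correlation of
-- x and h x is the Dedekind sum of h modulo p.  Hence (Schur's test) it suffices that
-- Σ_h |dedekind h p| ≤ p³ (log p)^O(1).  By reciprocity |dedekind h p| / p² is at most
-- three times the sum of the partial quotients of h / p, plus 1.  A partial quotient
-- following a convergent of denominator q is at most p / (q r) where r ≡ ± q h (mod p),
-- and summing p / (q r) over all q, r < p gives p (log p)².
open import Level using (0ℓ)
open import Algebra.Bundles using (CommutativeSemiring)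
import Algebra.Properties.Semiring.Sum as SemiringSum
open import Defs
open import Data.Bool using (true; false; if_then_else_; T)
open import Data.Fin using (Fin; toℕ; fromℕ<)
open import Data.Fin.Permutation using (Permutation; permutation)
open import Data.Fin.Properties using (toℕ<n; toℕ-fromℕ<; toℕ-injective)
open import Data.Integer as ℤ using (ℤ; +_; -[1+_]; 0ℤ; 1ℤ; ∣_∣)
import Data.Integer.Properties as ℤₚ
import Data.Integer.Tactic.RingSolver as ℤ-Ring
open import Data.List using (List; []; _∷_; length; applyUpTo)
open import Data.List.Relation.Unary.All using (All; []; _∷_)
open import Data.List.Relation.Unary.AllPairs using ([]; _∷_)
open import Data.List.Relation.Unary.Unique.Propositional using (Unique)
open import Data.Nat as ℕ using (ℕ; zero; suc; NonZero; z≤n; s≤s; s<s; z<s; _⊔_)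
open import Data.Nat.Coprimality as Coprime using (Coprime; coprime-Bézout; coprime-divisor; prime⇒coprime; 0-coprimeTo-m⇒m≡1)
open import Data.Nat.Divisibility using (_∣_; divides; ∣⇒≤; ∣m∣n⇒∣m+n; ∣n⇒∣m*n)
open import Data.Nat.DivMod using (_%_; _/_; m%n<n; m%n%n≡m%n; m<n⇒m%n≡m; m≡m%n+[m/n]*n; %-distribˡ-*; [m+n]%n≡m%n; [m+kn]%n≡m%n; 0/n≡0; m*n/n≡m; m/n*n≤m; m/n/o≡m/[n*o]; m<n*o⇒m/o<n; m≥n⇒m/n>0; /-monoˡ-≤; /-monoʳ-≤)
open import Data.Nat.GCD using (module Bézout)
open import Data.Nat.Induction using (Acc; acc; <-wellFounded)
open import Data.Nat.ListAction using () renaming (sum to sumᴺ)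
open import Data.Nat.Logarithm using (⌊log₂_⌋; ⌊log₂⌋-mono-≤; ⌊log₂[2^n]⌋≡n)
open import Data.Nat.Primality using (Prime; prime⇒nonTrivial)
import Data.Nat.Properties as ℕₚ
import Data.Nat.Tactic.RingSolver as ℕ-Ring
open import Data.Product using (∃-syntax; _,_; _×_; proj₁; proj₂)
open import Data.Sum using (inj₁; inj₂)
open import Function using (_∘_)
open import Relation.Nullary using (Dec; yes; no; does; ¬_; contradiction)
open import Relation.Nullary.Decidable using (dec-false)
open import Relation.Binary.PropositionalEquality

-- Units modulo `k` and the dilations they induce.

coprime⇒inverse : ∀ {h k} .{{_ : NonZero k}} → Coprime h k → ∃[ h' ] (h ℕ.* h') % k ≡ 1 % k
coprime⇒inverse {h} {k} c with coprime-Bézout c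
... | Bézout.+- x y eq = x , (begin
  (h ℕ.* x) % k       ≡⟨ cong (_% k) (trans (ℕₚ.*-comm h x) (sym eq)) ⟩
  (1 ℕ.+ y ℕ.* k) % k ≡⟨ [m+kn]%n≡m%n 1 y k ⟩
  1 % k               ∎)
  where open ≡-Reasoning
-- Here `h * x` is congruent to `- 1`, so `x` has to be negated; `k ∸ 1` is the natural number that
-- stands for `- 1`.
... | Bézout.-+ x y eq = x ℕ.* (k ℕ.∸ 1) , (begin
  (h ℕ.* (x ℕ.* (k ℕ.∸ 1))) % k                    ≡⟨ [m+kn]%n≡m%n _ y k ⟨
  (h ℕ.* (x ℕ.* (k ℕ.∸ 1)) ℕ.+ y ℕ.* k) % k        ≡⟨ cong (_% k) (bezout (k ℕ.∸ 1) k (ℕₚ.suc-pred k) eq) ⟩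
  (1 ℕ.+ (x ℕ.* h) ℕ.* k) % k                      ≡⟨ [m+kn]%n≡m%n 1 (x ℕ.* h) k ⟩
  1 % k                                            ∎)
  where
  open ≡-Reasoning
  poly : ∀ h x k → h ℕ.* (x ℕ.* k) ℕ.+ (1 ℕ.+ x ℕ.* h) ≡ 1 ℕ.+ (x ℕ.* h) ℕ.* suc k
  poly = ℕ-Ring.solve-∀
  bezout : ∀ k₁ k → suc k₁ ≡ k → 1 ℕ.+ x ℕ.* h ≡ y ℕ.* k →
           h ℕ.* (x ℕ.* k₁) ℕ.+ y ℕ.* k ≡ 1 ℕ.+ (x ℕ.* h) ℕ.* k
  bezout k₁ .(suc k₁) refl e = begin
    h ℕ.* (x ℕ.* k₁) ℕ.+ y ℕ.* suc k₁      ≡⟨ cong (h ℕ.* (x ℕ.* k₁) ℕ.+_) e ⟨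
    h ℕ.* (x ℕ.* k₁) ℕ.+ (1 ℕ.+ x ℕ.* h)   ≡⟨ poly h x k₁ ⟩
    1 ℕ.+ (x ℕ.* h) ℕ.* suc k₁             ∎

*-%ʳ : ∀ m n d .{{_ : NonZero d}} → (m ℕ.* (n % d)) % d ≡ (m ℕ.* n) % d
*-%ʳ m n d = begin
  (m ℕ.* (n % d)) % d             ≡⟨ %-distribˡ-* m (n % d) d ⟩
  ((m % d) ℕ.* (n % d % d)) % d   ≡⟨ cong (λ z → ((m % d) ℕ.* z) % d) (m%n%n≡m%n n d) ⟩
  ((m % d) ℕ.* (n % d)) % d       ≡⟨ %-distribˡ-* m n d ⟨
  (m ℕ.* n) % d                   ∎
  where open ≡-Reasoning

*-%ˡ : ∀ m n d .{{_ : NonZero d}} → ((m % d) ℕ.* n) % d ≡ (m ℕ.* n) % d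
*-%ˡ m n d = begin
  ((m % d) ℕ.* n) % d   ≡⟨ cong (_% d) (ℕₚ.*-comm (m % d) n) ⟩
  (n ℕ.* (m % d)) % d   ≡⟨ *-%ʳ n m d ⟩
  (n ℕ.* m) % d         ≡⟨ cong (_% d) (ℕₚ.*-comm n m) ⟩
  (m ℕ.* n) % d         ∎
  where open ≡-Reasoning

inverse-cancel : ∀ h h' {k} .{{_ : NonZero k}} a → (h ℕ.* h') % k ≡ 1 % k →
                 (h ℕ.* ((h' ℕ.* a) % k)) % k ≡ a % k
inverse-cancel h h' {k} a inv = begin
  (h ℕ.* ((h' ℕ.* a) % k)) % k   ≡⟨ *-%ʳ h _ k ⟩
  (h ℕ.* (h' ℕ.* a)) % k         ≡⟨ cong (_% k) (ℕₚ.*-assoc h h' a) ⟨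
  (h ℕ.* h' ℕ.* a) % k           ≡⟨ *-%ˡ (h ℕ.* h') a k ⟨
  ((h ℕ.* h') % k ℕ.* a) % k     ≡⟨ cong (λ z → (z ℕ.* a) % k) inv ⟩
  (1 % k ℕ.* a) % k              ≡⟨ *-%ˡ 1 a k ⟩
  (1 ℕ.* a) % k                  ≡⟨ cong (_% k) (ℕₚ.*-identityˡ a) ⟩
  a % k                          ∎
  where open ≡-Reasoning

dilation : ∀ h h' {k} .{{_ : NonZero k}} → (h ℕ.* h') % k ≡ 1 % k → Permutation k k
dilation h h' {k} inv = permutation (mul h) (mul h') (cancel h h' inv)
    (cancel h' h (trans (cong (_% k) (ℕₚ.*-comm h' h)) inv))
  where
  mul : ℕ → Fin k → Fin k
  mul u i = fromℕ< (m%n<n (u ℕ.* toℕ i) k)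
  cancel : ∀ u v → (u ℕ.* v) % k ≡ 1 % k → ∀ i → mul u (mul v i) ≡ i
  cancel u v uv i = toℕ-injective (begin
    toℕ (mul u (mul v i))               ≡⟨ toℕ-fromℕ< _ ⟩
    (u ℕ.* toℕ (mul v i)) % k           ≡⟨ cong (λ z → (u ℕ.* z) % k) (toℕ-fromℕ< _) ⟩
    (u ℕ.* ((v ℕ.* toℕ i) % k)) % k     ≡⟨ inverse-cancel u v (toℕ i) uv ⟩
    toℕ i % k                           ≡⟨ m<n⇒m%n≡m (toℕ<n i) ⟩
    toℕ i                               ∎)
    where open ≡-Reasoning

-- Finite sums over ranges and lists.

module RangeSum (R : CommutativeSemiring 0ℓ 0ℓ) where
  open CommutativeSemiring R renaming (refl to ≈-refl; sym to ≈-sym; trans to ≈-trans; reflexive to ≈-reflexive)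
  open SemiringSum semiring

  -- Built on sums over `Fin n` because these are invariant under a `Permutation`, which is what
  -- `∑-dilate` needs. `∑ (suc n) f` still unfolds to `f 0 + ∑ n (f ∘ suc)`, so inductions on `n`
  -- remain direct.
  ∑ : ℕ → (ℕ → Carrier) → Carrier
  ∑ n f = sum {n} (f ∘ toℕ)

  ∑ᴸ : {A : Set} → List A → (A → Carrier) → Carrier
  ∑ᴸ []       f = 0#
  ∑ᴸ (x ∷ xs) f = f x + ∑ᴸ xs f

  ∑-cong : ∀ n {f g : ℕ → Carrier} → (∀ i → i ℕ.< n → f i ≈ g i) → ∑ n f ≈ ∑ n g
  ∑-cong n eq = sum-cong-≋ (λ i → eq (toℕ i) (toℕ<n i))

  ∑-+ : ∀ n f g → ∑ n (λ i → f i + g i) ≈ ∑ n f + ∑ n g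
  ∑-+ n f g = ∑-distrib-+ {n} (f ∘ toℕ) (g ∘ toℕ)

  ∑-*ˡ : ∀ n c f → ∑ n (λ i → c * f i) ≈ c * ∑ n f
  ∑-*ˡ n c f = ≈-sym (*-distribˡ-sum {n} c (f ∘ toℕ))

  ∑-*ʳ : ∀ n c f → ∑ n (λ i → f i * c) ≈ ∑ n f * c
  ∑-*ʳ n c f = ≈-sym (*-distribʳ-sum {n} c (f ∘ toℕ))

  ∑-swap : ∀ m n (f : ℕ → ℕ → Carrier) →
           ∑ m (λ i → ∑ n (λ j → f i j)) ≈ ∑ n (λ j → ∑ m (λ i → f i j))
  ∑-swap m n f = ∑-comm {m} {n} (λ i j → f (toℕ i) (toℕ j))

  ∑-zero : ∀ n → ∑ n (λ _ → 0#) ≈ 0#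
  ∑-zero n = sum-replicate-zero n

  ∑-last : ∀ n f → ∑ (suc n) f ≈ ∑ n f + f n
  ∑-last zero    f = +-comm _ _
  ∑-last (suc n) f = ≈-trans (+-congˡ (∑-last n (f ∘ suc))) (≈-sym (+-assoc _ _ _))

  ∑-split : ∀ m n f → ∑ (m ℕ.+ n) f ≈ ∑ m f + ∑ n (λ i → f (m ℕ.+ i))
  ∑-split zero    n f = ≈-sym (+-identityˡ _)
  ∑-split (suc m) n f = ≈-trans (+-congˡ (∑-split m n (f ∘ suc))) (≈-sym (+-assoc _ _ _))

  -- Multiplication by a unit permutes the residues. This is the change of variables behind the
  -- moment identities, the averaging over `h`, the doubling of multipliers and the passage from
  -- correlations to Dedekind sums.
  ∑-dilate : ∀ h {k} .{{_ : NonZero k}} → Coprime h k → ∀ f →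
             ∑ k (λ a → f ((h ℕ.* a) % k)) ≈ ∑ k f
  ∑-dilate h {k} c f with coprime⇒inverse c
  ... | h' , inv = ≈-sym (≈-trans (sum-permute (f ∘ toℕ) (dilation h h' inv))
                     (sum-cong-≋ {k} (λ i → ≈-reflexive (cong f (toℕ-fromℕ< _)))))

  ∑ᴸ-cong : ∀ {A : Set} (xs : List A) {f g : A → Carrier} → (∀ x → f x ≈ g x) → ∑ᴸ xs f ≈ ∑ᴸ xs g
  ∑ᴸ-cong []       eq = ≈-refl
  ∑ᴸ-cong (x ∷ xs) eq = +-cong (eq x) (∑ᴸ-cong xs eq)

  ∑ᴸ-*ˡ : ∀ {A : Set} (xs : List A) c f → ∑ᴸ xs (λ x → c * f x) ≈ c * ∑ᴸ xs f
  ∑ᴸ-*ˡ []       c f = ≈-sym (zeroʳ c)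
  ∑ᴸ-*ˡ (x ∷ xs) c f = ≈-trans (+-congˡ (∑ᴸ-*ˡ xs c f)) (≈-sym (distribˡ _ _ _))

  ∑ᴸ-*ʳ : ∀ {A : Set} (xs : List A) c f → ∑ᴸ xs (λ x → f x * c) ≈ ∑ᴸ xs f * c
  ∑ᴸ-*ʳ []       c f = ≈-sym (zeroˡ c)
  ∑ᴸ-*ʳ (x ∷ xs) c f = ≈-trans (+-congˡ (∑ᴸ-*ʳ xs c f)) (≈-sym (distribʳ _ _ _))

  ∑-∑ᴸ-swap : ∀ {A : Set} n (xs : List A) (f : ℕ → A → Carrier) →
              ∑ n (λ i → ∑ᴸ xs (f i)) ≈ ∑ᴸ xs (λ x → ∑ n (λ i → f i x))
  ∑-∑ᴸ-swap n []       f = ∑-zero n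
  ∑-∑ᴸ-swap n (x ∷ xs) f = ≈-trans (∑-+ n (λ i → f i x) (λ i → ∑ᴸ xs (f i)))
                                   (+-congˡ (∑-∑ᴸ-swap n xs f))

open RangeSum ℤₚ.+-*-commutativeSemiring
module ℕΣ = RangeSum ℕₚ.+-*-commutativeSemiring

n<2^[1+log₂n] : ∀ n → n ℕ.< 2 ℕ.^ suc ⌊log₂ n ⌋
n<2^[1+log₂n] n = ℕₚ.≰⇒> (λ 2^≤n → ℕₚ.1+n≰n
  (subst (ℕ._≤ ⌊log₂ n ⌋) (⌊log₂[2^n]⌋≡n (suc ⌊log₂ n ⌋)) (⌊log₂⌋-mono-≤ 2^≤n)))

module Correlations where
  open import Data.Integer using (-_; _+_; _*_; _-_)

  -- Indicators and power sums.

  χ : {P : Set} → Dec P → ℤ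
  χ d = if does d then 1ℤ else 0ℤ

  χ-yes : {P : Set} (d : Dec P) → P → χ d ≡ 1ℤ
  χ-yes (yes _) p = refl
  χ-yes (no ¬p) p = contradiction p ¬p

  χ-no : {P : Set} (d : Dec P) → ¬ P → χ d ≡ 0ℤ
  χ-no (yes p) ¬p = contradiction p ¬p
  χ-no (no _)  ¬p = refl

  χ-cong : {P Q : Set} (d : Dec P) (e : Dec Q) → (P → Q) → (Q → P) → χ d ≡ χ e
  χ-cong d (yes q) to from = χ-yes d (from q)
  χ-cong d (no ¬q) to from = χ-no d (¬q ∘ to)

  ∑-const : ∀ n c → ∑ n (λ _ → c) ≡ + n * c
  ∑-const zero    c = sym (ℤₚ.*-zeroˡ c)
  ∑-const (suc n) c = begin
    c + ∑ n (λ _ → c)  ≡⟨ cong (λ z → c + z) (∑-const n c) ⟩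
    c + + n * c        ≡⟨ ℤₚ.suc-* (+ n) c ⟨
    + suc n * c        ∎
    where open ≡-Reasoning

  ∑-truncate : ∀ n m (w : ℕ → ℤ) → m ℕ.≤ n → ∑ n (λ j → w j * χ (j ℕ.<? m)) ≡ ∑ m w
  ∑-truncate n m w m≤n = begin
    ∑ n t                                      ≡⟨ cong (λ z → ∑ z t) (ℕₚ.m+[n∸m]≡n m≤n) ⟨
    ∑ (m ℕ.+ d) t                              ≡⟨ ∑-split m d t ⟩
    ∑ m t + ∑ d (λ i → t (m ℕ.+ i))            ≡⟨ cong₂ _+_ (∑-cong m inside) (∑-cong d outside) ⟩
    ∑ m w + ∑ d (λ _ → 0ℤ)                     ≡⟨ cong (λ z → ∑ m w + z) (∑-zero d) ⟩
    ∑ m w + 0ℤ                                 ≡⟨ ℤₚ.+-identityʳ _ ⟩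
    ∑ m w                                      ∎
    where
    open ≡-Reasoning
    d = n ℕ.∸ m
    t = λ j → w j * χ (j ℕ.<? m)
    inside : ∀ i → i ℕ.< m → t i ≡ w i
    inside i i<m = trans (cong (w i *_) (χ-yes (i ℕ.<? m) i<m)) (ℤₚ.*-identityʳ (w i))
    outside : ∀ i → i ℕ.< d → t (m ℕ.+ i) ≡ 0ℤ
    outside i _ = trans (cong (w (m ℕ.+ i) *_) (χ-no (m ℕ.+ i ℕ.<? m) (ℕₚ.m+n≮m m i)))
                        (ℤₚ.*-zeroʳ (w (m ℕ.+ i)))

  -- A weight whose partial sums are squares: a column of lattice points weighted in this way adds
  -- up to the square of its height.
  odd : ℕ → ℤ
  odd j = + 2 * + j + 1ℤ

  ∑-odd : ∀ n → ∑ n odd ≡ + n * + n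
  ∑-odd zero    = refl
  ∑-odd (suc n) = begin
    ∑ (suc n) odd          ≡⟨ ∑-last n odd ⟩
    ∑ n odd + odd n        ≡⟨ cong (_+ odd n) (∑-odd n) ⟩
    + n * + n + odd n      ≡⟨ poly (+ n) ⟩
    + suc n * + suc n      ∎
    where
    open ≡-Reasoning
    poly : ∀ n → n * n + (+ 2 * n + 1ℤ) ≡ (1ℤ + n) * (1ℤ + n)
    poly = ℤ-Ring.solve-∀

  ∑-linear : ∀ n → + 2 * ∑ n (+_) ≡ + n * (+ n - 1ℤ)
  ∑-linear zero    = refl
  ∑-linear (suc n) = begin
    + 2 * ∑ (suc n) (+_)              ≡⟨ cong (+ 2 *_) (∑-last n (+_)) ⟩
    + 2 * (∑ n (+_) + + n)            ≡⟨ ℤₚ.*-distribˡ-+ (+ 2) (∑ n (+_)) (+ n) ⟩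
    + 2 * ∑ n (+_) + + 2 * + n        ≡⟨ cong (_+ + 2 * + n) (∑-linear n) ⟩
    + n * (+ n - 1ℤ) + + 2 * + n    ≡⟨ poly (+ n) ⟩
    + suc n * (+ suc n - 1ℤ)        ∎
    where
    open ≡-Reasoning
    poly : ∀ n → n * (n - 1ℤ) + + 2 * n ≡ (1ℤ + n) * ((1ℤ + n) - 1ℤ)
    poly = ℤ-Ring.solve-∀

  sq : ℕ → ℤ
  sq a = + a * + a

  ∑-sq : ∀ n → + 6 * ∑ n sq ≡ + n * (+ n - 1ℤ) * (+ 2 * + n - 1ℤ)
  ∑-sq zero    = refl
  ∑-sq (suc n) = begin
    + 6 * ∑ (suc n) sq                  ≡⟨ cong (+ 6 *_) (∑-last n sq) ⟩
    + 6 * (∑ n sq + sq n)               ≡⟨ ℤₚ.*-distribˡ-+ (+ 6) (∑ n sq) (sq n) ⟩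
    + 6 * ∑ n sq + + 6 * sq n           ≡⟨ cong (_+ + 6 * sq n) (∑-sq n) ⟩
    + n * (+ n - 1ℤ) * (+ 2 * + n - 1ℤ) + + 6 * sq n    ≡⟨ poly (+ n) ⟩
    + suc n * (+ suc n - 1ℤ) * (+ 2 * + suc n - 1ℤ)     ∎
    where
    open ≡-Reasoning
    poly : ∀ n → n * (n - 1ℤ) * (+ 2 * n - 1ℤ) + + 6 * (n * n)
               ≡ (1ℤ + n) * ((1ℤ + n) - 1ℤ) * (+ 2 * (1ℤ + n) - 1ℤ)
    poly = ℤ-Ring.solve-∀

  -- Lattice points on the two sides of a diagonal.

  floor : (h k : ℕ) .{{_ : NonZero k}} → ℕ → ℕ
  floor h k a = h ℕ.* a / k

  -- The index `j` stands for the height `suc j`, and the heights on or below the line at abscissa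
  -- `suc a` are those with `j` less than the floor. The condition `a < K` keeps that floor at most
  -- `H`, so the range of `j` cuts nothing off.
  ∑-below-line : ∀ H K a (w : ℕ → ℤ) → a ℕ.< K →
    ∑ H (λ j → w j * χ (suc K ℕ.* suc j ℕ.≤? suc H ℕ.* suc a)) ≡ ∑ (floor (suc H) (suc K) (suc a)) w
  ∑-below-line H K a w a<K = trans
    (∑-cong H (λ j _ → cong (w j *_) (χ-cong (k ℕ.* suc j ℕ.≤? h ℕ.* suc a) (j ℕ.<? f) to from)))
    (∑-truncate H f w (ℕₚ.≤-pred (m<n*o⇒m/o<n (ℕₚ.*-monoʳ-< h (s≤s a<K)))))
    where
    h = suc H
    k = suc K
    f = floor h k (suc a)
    to : ∀ {j} → k ℕ.* suc j ℕ.≤ h ℕ.* suc a → j ℕ.< f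
    to {j} le = subst (ℕ._≤ f) (trans (cong (_/ k) (ℕₚ.*-comm k (suc j))) (m*n/n≡m (suc j) k)) (/-monoˡ-≤ k le)
    from : ∀ {j} → j ℕ.< f → k ℕ.* suc j ℕ.≤ h ℕ.* suc a
    from {j} lt = ℕₚ.≤-trans (ℕₚ.≤-reflexive (ℕₚ.*-comm k (suc j)))
      (ℕₚ.≤-trans (ℕₚ.*-monoˡ-≤ k lt) (m/n*n≤m (h ℕ.* suc a) k))

  -- Equality would make `suc K` divide `suc H * suc a`, hence by coprimality `suc a`, which is
  -- smaller than `suc K`.
  diagonal-free : ∀ {H K} → Coprime (suc H) (suc K) → ∀ a j → a ℕ.< K →
    suc H ℕ.* suc a ≢ suc K ℕ.* suc j
  diagonal-free {H} {K} c a j a<K eq = ℕₚ.<⇒≱ (s≤s a<K) (∣⇒≤ (coprime-divisor (Coprime.sym c)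
    (divides (suc j) (trans eq (ℕₚ.*-comm (suc K) (suc j))))))

  χ-trichotomy : ∀ m n → m ≢ n → χ (m ℕ.≤? n) + χ (n ℕ.≤? m) ≡ 1ℤ
  χ-trichotomy m n m≢n with m ℕ.≤? n
  ... | yes m≤n = cong₂ _+_ (χ-yes (m ℕ.≤? n) m≤n) (χ-no (n ℕ.≤? m) (λ n≤m → m≢n (ℕₚ.≤-antisym m≤n n≤m)))
  ... | no  m≰n = cong₂ _+_ (χ-no (m ℕ.≤? n) m≰n) (χ-yes (n ℕ.≤? m) (ℕₚ.<⇒≤ (ℕₚ.≰⇒> m≰n)))

  -- Coprimality keeps the lattice points of the open rectangle off its diagonal, so each
  -- one lies in exactly one of the two triangles; the point in row j has weight odd j.
  lattice-count : ∀ H K → Coprime (suc H) (suc K) →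
    let f = floor (suc H) (suc K); g = floor (suc K) (suc H) in
    ∑ K (λ a → sq (f (suc a))) + ∑ H (λ j → odd j * + g (suc j)) ≡ + K * (+ H * + H)
  lattice-count H K c = begin
    ∑ K (λ a → sq (f (suc a))) + ∑ H (λ j → odd j * + g (suc j))
      ≡⟨ cong₂ _+_ (∑-cong K (λ a a<K → sym (row a a<K))) (∑-cong H (λ j j<H → sym (column j j<H))) ⟩
    ∑ K (λ a → ∑ H (λ j → odd j * below a j)) + ∑ H (λ j → ∑ K (λ a → odd j * above a j))
      ≡⟨ cong (λ z → ∑ K (λ a → ∑ H (λ j → odd j * below a j)) + z) (∑-swap H K (λ j a → odd j * above a j)) ⟩
    ∑ K (λ a → ∑ H (λ j → odd j * below a j)) + ∑ K (λ a → ∑ H (λ j → odd j * above a j))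
      ≡⟨ ∑-+ K (λ a → ∑ H (λ j → odd j * below a j)) (λ a → ∑ H (λ j → odd j * above a j)) ⟨
    ∑ K (λ a → ∑ H (λ j → odd j * below a j) + ∑ H (λ j → odd j * above a j))
      ≡⟨ ∑-cong K (λ a a<K → trans (sym (∑-+ H (λ j → odd j * below a j) (λ j → odd j * above a j)))
                                   (∑-cong H (λ j _ → one a j a<K))) ⟩
    ∑ K (λ a → ∑ H odd)
      ≡⟨ ∑-cong K (λ _ _ → ∑-odd H) ⟩
    ∑ K (λ a → + H * + H)
      ≡⟨ ∑-const K _ ⟩
    + K * (+ H * + H) ∎
    where
    open ≡-Reasoning
    f = floor (suc H) (suc K)
    g = floor (suc K) (suc H)
    below above : ℕ → ℕ → ℤ
    below a j = χ (suc K ℕ.* suc j ℕ.≤? suc H ℕ.* suc a)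
    above a j = χ (suc H ℕ.* suc a ℕ.≤? suc K ℕ.* suc j)
    row : ∀ a → a ℕ.< K → ∑ H (λ j → odd j * below a j) ≡ sq (f (suc a))
    row a a<K = trans (∑-below-line H K a odd a<K) (∑-odd (f (suc a)))
    column : ∀ j → j ℕ.< H → ∑ K (λ a → odd j * above a j) ≡ odd j * + g (suc j)
    column j j<H = begin
      ∑ K (λ a → odd j * above a j)          ≡⟨ ∑-*ˡ K (odd j) (λ a → above a j) ⟩
      odd j * ∑ K (λ a → above a j)          ≡⟨ cong (odd j *_) (∑-cong K (λ a _ → sym (ℤₚ.*-identityˡ (above a j)))) ⟩
      odd j * ∑ K (λ a → 1ℤ * above a j)     ≡⟨ cong (odd j *_) (∑-below-line K H j (λ _ → 1ℤ) j<H) ⟩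
      odd j * ∑ (g (suc j)) (λ _ → 1ℤ)       ≡⟨ cong (odd j *_) (trans (∑-const (g (suc j)) 1ℤ) (ℤₚ.*-identityʳ _)) ⟩
      odd j * + g (suc j)                    ∎
    one : ∀ a j → a ℕ.< K → odd j * below a j + odd j * above a j ≡ odd j
    one a j a<K = begin
      odd j * below a j + odd j * above a j   ≡⟨ ℤₚ.*-distribˡ-+ (odd j) (below a j) (above a j) ⟨
      odd j * (below a j + above a j)         ≡⟨ cong (odd j *_) (χ-trichotomy _ _ (λ e → diagonal-free c a j a<K (sym e))) ⟩
      odd j * 1ℤ                              ≡⟨ ℤₚ.*-identityʳ (odd j) ⟩
      odd j                                   ∎

  -- Moments of floors, Dedekind sums and their reciprocity law.

  combine : List (ℤ × (ℕ → ℤ)) → ℕ → ℤ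
  combine ts a = ∑ᴸ ts (λ t → proj₁ t * proj₂ t a)

  ∑-combine : ∀ n ts → ∑ n (combine ts) ≡ ∑ᴸ ts (λ t → proj₁ t * ∑ n (proj₂ t))
  ∑-combine n ts = trans (∑-∑ᴸ-swap n ts (λ a t → proj₁ t * proj₂ t a))
                         (∑ᴸ-cong ts (λ t → ∑-*ˡ n (proj₁ t) (proj₂ t)))

  -- Sums a whole linear combination, given as a list of coefficients and functions, in one step.
  -- The end of the list leaves the trailing `+ 0ℤ` seen in the polynomial identities that follow.
  ∑-expand : ∀ n {f} ts → (∀ a → f a ≡ combine ts a) → ∑ n f ≡ ∑ᴸ ts (λ t → proj₁ t * ∑ n (proj₂ t))
  ∑-expand n ts eq = trans (∑-cong n (λ a _ → eq a)) (∑-combine n ts)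

  -- In terms of the sawtooth, saw k t = 2k ((t / k)), except that saw k t = - k when k ∣ t.
  saw : (k : ℕ) .{{_ : NonZero k}} → ℕ → ℤ
  saw k t = + 2 * + (t % k) - + k

  -- For coprime h and k this is 4k² s(h , k) + k², where s is the classical Dedekind sum.
  dedekind : (h k : ℕ) .{{_ : NonZero k}} → ℤ
  dedekind h k = ∑ k (λ a → (+ 2 * + a - + k) * saw k (h ℕ.* a))

  module Moments (h k : ℕ) .{{_ : NonZero k}} (c : Coprime h k) where

    f : ℕ → ℕ
    f = floor h k

    a·f f² : ℕ → ℤ
    a·f a = + a * + f a
    f² = sq ∘ f

    residue : ∀ a → + (h ℕ.* a % k) ≡ + h * + a - + k * + f a
    residue a = begin
      + r                                  ≡⟨ poly (+ r) (+ f a) (+ k) ⟩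
      (+ r + + f a * + k) - + k * + f a    ≡⟨ cong (λ z → (+ r + z) - + k * + f a) (ℤₚ.pos-* (f a) k) ⟨
      + (r ℕ.+ f a ℕ.* k) - + k * + f a    ≡⟨ cong (λ z → + z - + k * + f a) (m≡m%n+[m/n]*n (h ℕ.* a) k) ⟨
      + (h ℕ.* a) - + k * + f a            ≡⟨ cong (λ z → z - + k * + f a) (ℤₚ.pos-* h a) ⟩
      + h * + a - + k * + f a              ∎
      where
      open ≡-Reasoning
      r = h ℕ.* a % k
      poly : ∀ r f k → r ≡ (r + f * k) - k * f
      poly = ℤ-Ring.solve-∀

    -- Multiplication by `h` permutes the residues modulo `k`, so summing `residue` over all `a`
    -- gives back the sum of the residues themselves. The second moment does the same with squares.
    first-moment : + h * ∑ k (+_) - + k * ∑ k ((+_) ∘ f) ≡ ∑ k (+_)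
    first-moment = begin
      + h * ∑ k (+_) - + k * ∑ k ((+_) ∘ f)                       ≡⟨ shape (+ h) (+ k) (∑ k (+_)) (∑ k ((+_) ∘ f)) ⟩
      + h * ∑ k (+_) + (- + k * ∑ k ((+_) ∘ f) + 0ℤ)              ≡⟨ ∑-expand k ((+ h , (+_)) ∷ (- + k , (+_) ∘ f) ∷ []) (λ a → trans (residue a) (shape (+ h) (+ k) (+ a) (+ f a))) ⟨
      ∑ k (λ a → + (h ℕ.* a % k))                             ≡⟨ ∑-dilate h c (+_) ⟩
      ∑ k (+_)                                                  ∎
      where
      open ≡-Reasoning
      shape : ∀ h k a f → h * a - k * f ≡ h * a + (- k * f + 0ℤ)
      shape = ℤ-Ring.solve-∀

    second-moment : + h * + h * ∑ k sq - + 2 * + h * + k * ∑ k a·f + + k * + k * ∑ k f² ≡ ∑ k sq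
    second-moment = begin
      + h * + h * ∑ k sq - + 2 * + h * + k * ∑ k a·f + + k * + k * ∑ k f²
        ≡⟨ shape (+ h) (+ k) (∑ k sq) (∑ k a·f) (∑ k f²) ⟩
      + h * + h * ∑ k sq + (- (+ 2 * + h * + k) * ∑ k a·f + (+ k * + k * ∑ k f² + 0ℤ))
        ≡⟨ ∑-expand k ((+ h * + h , sq) ∷ (- (+ 2 * + h * + k) , a·f) ∷ (+ k * + k , f²) ∷ [])
             (λ a → trans (cong₂ _*_ (residue a) (residue a)) (expand (+ h) (+ k) (+ a) (+ f a))) ⟨
      ∑ k (λ a → sq (h ℕ.* a % k))
        ≡⟨ ∑-dilate h c sq ⟩
      ∑ k sq ∎
      where
      open ≡-Reasoning
      shape : ∀ h k A U V → h * h * A - + 2 * h * k * U + k * k * V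
                          ≡ h * h * A + (- (+ 2 * h * k) * U + (k * k * V + 0ℤ))
      shape = ℤ-Ring.solve-∀
      expand : ∀ h k a f → (h * a - k * f) * (h * a - k * f)
                         ≡ h * h * (a * a) + (- (+ 2 * h * k) * (a * f) + (k * k * (f * f) + 0ℤ))
      expand = ℤ-Ring.solve-∀

    -- The floor is introduced only in the product of `a` with its residue; in the term linear in
    -- the residue, dilation restores `∑ k (+_)`. Thus the mixed moment `a·f` is the only floor
    -- moment that survives.
    dedekind-moments : dedekind h k ≡ + 4 * + h * ∑ k sq - + 4 * + k * ∑ k a·f - + 4 * + k * ∑ k (+_) + + k * + k * + k
    dedekind-moments = begin
      dedekind h k
        ≡⟨ ∑-expand k ((+ 4 * + h , sq) ∷ (- (+ 4 * + k) , a·f) ∷ (- (+ 2 * + k) , (+_)) ∷ (- (+ 2 * + k) , m)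
                        ∷ (+ k * + k , (λ _ → 1ℤ)) ∷ []) summand ⟩
      + 4 * + h * ∑ k sq + (- (+ 4 * + k) * ∑ k a·f + (- (+ 2 * + k) * ∑ k (+_)
        + (- (+ 2 * + k) * ∑ k m + (+ k * + k * ∑ k (λ _ → 1ℤ) + 0ℤ))))
        ≡⟨ cong₂ (λ x y → + 4 * + h * ∑ k sq + (- (+ 4 * + k) * ∑ k a·f + (- (+ 2 * + k) * ∑ k (+_)
                   + (- (+ 2 * + k) * x + (+ k * + k * y + 0ℤ)))))
                 (∑-dilate h c (+_)) (∑-const k 1ℤ) ⟩
      + 4 * + h * ∑ k sq + (- (+ 4 * + k) * ∑ k a·f + (- (+ 2 * + k) * ∑ k (+_)
        + (- (+ 2 * + k) * ∑ k (+_) + (+ k * + k * (+ k * 1ℤ) + 0ℤ))))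
        ≡⟨ shape (+ h) (+ k) (∑ k sq) (∑ k a·f) (∑ k (+_)) ⟩
      + 4 * + h * ∑ k sq - + 4 * + k * ∑ k a·f - + 4 * + k * ∑ k (+_) + + k * + k * + k ∎
      where
      open ≡-Reasoning
      m : ℕ → ℤ
      m a = + (h ℕ.* a % k)
      shape : ∀ h k A U B → + 4 * h * A + (- (+ 4 * k) * U + (- (+ 2 * k) * B + (- (+ 2 * k) * B + (k * k * (k * 1ℤ) + 0ℤ))))
                          ≡ + 4 * h * A - + 4 * k * U - + 4 * k * B + k * k * k
      shape = ℤ-Ring.solve-∀
      cross : ∀ k a m → (+ 2 * a - k) * (+ 2 * m - k) ≡ + 4 * a * m - + 2 * k * a - + 2 * k * m + k * k
      cross = ℤ-Ring.solve-∀
      collect : ∀ h k a f m → + 4 * a * (h * a - k * f) - + 2 * k * a - + 2 * k * m + k * k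
        ≡ + 4 * h * (a * a) + (- (+ 4 * k) * (a * f) + (- (+ 2 * k) * a + (- (+ 2 * k) * m + (k * k * 1ℤ + 0ℤ))))
      collect = ℤ-Ring.solve-∀
      summand : ∀ a → _ ≡ _
      summand a = begin
        (+ 2 * + a - + k) * (+ 2 * m a - + k)
          ≡⟨ cross (+ k) (+ a) (m a) ⟩
        + 4 * + a * m a - + 2 * + k * + a - + 2 * + k * m a + + k * + k
          ≡⟨ cong (λ z → + 4 * + a * z - + 2 * + k * + a - + 2 * + k * m a + + k * + k) (residue a) ⟩
        + 4 * + a * (+ h * + a - + k * + f a) - + 2 * + k * + a - + 2 * + k * m a + + k * + k
          ≡⟨ collect (+ h) (+ k) (+ a) (+ f a) (m a) ⟩
        _ ∎

  floor-0 : ∀ h k .{{_ : NonZero k}} → floor h k 0 ≡ 0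
  floor-0 h k = trans (cong (_/ k) (ℕₚ.*-zeroʳ h)) (0/n≡0 k)

  -- The lattice count with sums extended to index 0, where both floors vanish. Since `odd j` is
  -- twice `suc j` minus 1, the weighted sum splits into a mixed and a plain moment.
  lattice-moments : ∀ h k .{{_ : NonZero h}} .{{_ : NonZero k}} → Coprime h k →
    ∑ k (sq ∘ floor h k) + + 2 * ∑ h (λ j → + j * + floor k h j) - ∑ h ((+_) ∘ floor k h)
      ≡ (+ k - 1ℤ) * ((+ h - 1ℤ) * (+ h - 1ℤ))
  lattice-moments h@(suc H) k@(suc K) c = begin
    ∑ k (sq ∘ f) + + 2 * ∑ h (λ j → + j * + g j) - ∑ h ((+_) ∘ g)
      ≡⟨ cong₂ (λ x y → (sq x + V) + + 2 * (0ℤ * + g 0 + U) - (+ y + G)) (floor-0 h k) (floor-0 k h) ⟩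
    (0ℤ + V) + + 2 * (0ℤ * + g 0 + U) - (0ℤ + G)
      ≡⟨ shape V U G (+ g 0) ⟩
    V + (+ 2 * U + (- 1ℤ * G + 0ℤ))
      ≡⟨ cong (λ z → V + z) (∑-expand H ((+ 2 , (λ j → + suc j * + g (suc j))) ∷ (- 1ℤ , (λ j → + g (suc j))) ∷ [])
            (λ j → split (+ j) (+ g (suc j)))) ⟨
    V + ∑ H (λ j → odd j * + g (suc j))
      ≡⟨ lattice-count H K c ⟩
    + K * (+ H * + H)
      ≡⟨ pred-form (+ H) (+ K) ⟩
    (+ k - 1ℤ) * ((+ h - 1ℤ) * (+ h - 1ℤ)) ∎
    where
    open ≡-Reasoning
    f = floor h k
    g = floor k h
    V = ∑ K (λ a → sq (f (suc a)))
    U = ∑ H (λ j → + suc j * + g (suc j))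
    G = ∑ H (λ j → + g (suc j))
    shape : ∀ V U G z → (0ℤ + V) + + 2 * (0ℤ * z + U) - (0ℤ + G) ≡ V + (+ 2 * U + (- 1ℤ * G + 0ℤ))
    shape = ℤ-Ring.solve-∀
    split : ∀ j y → (+ 2 * j + 1ℤ) * y ≡ + 2 * ((1ℤ + j) * y) + (- 1ℤ * y + 0ℤ)
    split = ℤ-Ring.solve-∀
    pred-form : ∀ H K → K * (H * H) ≡ ((1ℤ + K) - 1ℤ) * (((1ℤ + H) - 1ℤ) * ((1ℤ + H) - 1ℤ))
    pred-form = ℤ-Ring.solve-∀

  -- Dedekind's reciprocity law, cleared of denominators. The second moment trades the mixed moment
  -- of `h / k` for the sum of squared floors, and the lattice count trades that for the mixed
  -- moment of `k / h`, which cancels against the one inside `dedekind k h`.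
  reciprocity : ∀ h k .{{_ : NonZero h}} .{{_ : NonZero k}} → Coprime h k →
    + 3 * (+ h * + h * dedekind h k + + k * + k * dedekind k h)
      ≡ + 3 * (+ h * + h * (+ k * + k)) + + h * + k * (+ h * + h + + k * + k + 1ℤ)
  reciprocity h k c = ℤₚ.i-j≡0⇒i≡j _ _ (begin
    + 3 * (+ h * + h * dedekind h k + + k * + k * dedekind k h)
      - (+ 3 * (+ h * + h * (+ k * + k)) + + h * + k * (+ h * + h + + k * + k + 1ℤ))
      ≡⟨ cong₂ (λ x y → + 3 * (+ h * + h * x + + k * + k * y)
                  - (+ 3 * (+ h * + h * (+ k * + k)) + + h * + k * (+ h * + h + + k * + k + 1ℤ)))
               HK.dedekind-moments KH.dedekind-moments ⟩
    _ ≡⟨ certificate (+ h) (+ k) (∑ k sq) (∑ k (+_)) (∑ k HK.a·f) (∑ k HK.f²) (∑ h sq) (∑ h (+_)) (∑ h KH.a·f) (∑ h ((+_) ∘ KH.f)) ⟩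
    _ ≡⟨ vanish (+ 6 * + h) (- (+ 6 * + h * + k * + k)) (+ 6 * + k * + k) (+ h * + h * + h + + h) (- (+ 6 * + h * + h * + k))
                  (+ 2 * + k * + k * + k) (- (+ 6 * + h * + k * + k + + 3 * + k * + k * (+ k - 1ℤ)))
                (ℤₚ.i≡j⇒i-j≡0 HK.second-moment) (ℤₚ.i≡j⇒i-j≡0 (lattice-moments h k c))
                (ℤₚ.i≡j⇒i-j≡0 KH.first-moment)
                (ℤₚ.i≡j⇒i-j≡0 (∑-sq k)) (ℤₚ.i≡j⇒i-j≡0 (∑-linear k))
                (ℤₚ.i≡j⇒i-j≡0 (∑-sq h)) (ℤₚ.i≡j⇒i-j≡0 (∑-linear h)) ⟩
    0ℤ ∎)
    where
    open ≡-Reasoning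
    module HK = Moments h k c
    module KH = Moments k h (Coprime.sym c)
    -- The coefficients eliminate the unknown moments U, V, U', G, A, B one after the other.
    certificate : ∀ h k A B U V A' B' U' G →
      + 3 * (h * h * (+ 4 * h * A - + 4 * k * U - + 4 * k * B + k * k * k)
           + k * k * (+ 4 * k * A' - + 4 * h * U' - + 4 * h * B' + h * h * h))
        - (+ 3 * (h * h * (k * k)) + h * k * (h * h + k * k + 1ℤ))
      ≡ + 6 * h * (h * h * A - + 2 * h * k * U + k * k * V - A)
        + - (+ 6 * h * k * k) * (V + + 2 * U' - G - (k - 1ℤ) * ((h - 1ℤ) * (h - 1ℤ)))
        + + 6 * k * k * (k * B' - h * G - B')
        + (h * h * h + h) * (+ 6 * A - k * (k - 1ℤ) * (+ 2 * k - 1ℤ))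
        + - (+ 6 * h * h * k) * (+ 2 * B - k * (k - 1ℤ))
        + + 2 * k * k * k * (+ 6 * A' - h * (h - 1ℤ) * (+ 2 * h - 1ℤ))
        + - (+ 6 * h * k * k + + 3 * k * k * (k - 1ℤ)) * (+ 2 * B' - h * (h - 1ℤ))
    certificate = ℤ-Ring.solve-∀
    vanish : ∀ c₁ c₂ c₃ c₄ c₅ c₆ c₇ {z₁ z₂ z₃ z₄ z₅ z₆ z₇} →
      z₁ ≡ 0ℤ → z₂ ≡ 0ℤ → z₃ ≡ 0ℤ → z₄ ≡ 0ℤ → z₅ ≡ 0ℤ → z₆ ≡ 0ℤ → z₇ ≡ 0ℤ →
      c₁ * z₁ + c₂ * z₂ + c₃ * z₃ + c₄ * z₄ + c₅ * z₅ + c₆ * z₆ + c₇ * z₇ ≡ 0ℤ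
    vanish c₁ c₂ c₃ c₄ c₅ c₆ c₇ refl refl refl refl refl refl refl = zeros c₁ c₂ c₃ c₄ c₅ c₆ c₇
      where
      zeros : ∀ c₁ c₂ c₃ c₄ c₅ c₆ c₇ → c₁ * 0ℤ + c₂ * 0ℤ + c₃ * 0ℤ + c₄ * 0ℤ + c₅ * 0ℤ + c₆ * 0ℤ + c₇ * 0ℤ ≡ 0ℤ
      zeros = ℤ-Ring.solve-∀


  -- Absolute values, and one Euclidean step for Dedekind sums.

  ∑ᴺ-mono : ∀ n {f g : ℕ → ℕ} → (∀ i → i ℕ.< n → f i ℕ.≤ g i) → ℕΣ.∑ n f ℕ.≤ ℕΣ.∑ n g
  ∑ᴺ-mono zero    f≤g = z≤n
  ∑ᴺ-mono (suc n) f≤g = ℕₚ.+-mono-≤ (f≤g 0 z<s) (∑ᴺ-mono n (λ i i<n → f≤g (suc i) (s<s i<n)))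

  ∑ᴺ-const : ∀ n c → ℕΣ.∑ n (λ _ → c) ≡ n ℕ.* c
  ∑ᴺ-const zero    c = refl
  ∑ᴺ-const (suc n) c = cong (c ℕ.+_) (∑ᴺ-const n c)

  ∑ᴺ-extend : ∀ {m n} → m ℕ.≤ n → ∀ f → ℕΣ.∑ m f ℕ.≤ ℕΣ.∑ n f
  ∑ᴺ-extend z≤n       f = z≤n
  ∑ᴺ-extend (s≤s m≤n) f = ℕₚ.+-monoʳ-≤ (f 0) (∑ᴺ-extend m≤n (f ∘ suc))

  ∣∑∣≤∑∣∣ : ∀ n f → ∣ ∑ n f ∣ ℕ.≤ ℕΣ.∑ n (∣_∣ ∘ f)
  ∣∑∣≤∑∣∣ zero    f = z≤n
  ∣∑∣≤∑∣∣ (suc n) f = ℕₚ.≤-trans (ℤₚ.∣i+j∣≤∣i∣+∣j∣ (f 0) (∑ n (f ∘ suc)))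
                                 (ℕₚ.+-monoʳ-≤ ∣ f 0 ∣ (∣∑∣≤∑∣∣ n (f ∘ suc)))

  dedekind-% : ∀ h k .{{_ : NonZero h}} → dedekind (k % h) h ≡ dedekind k h
  dedekind-% h k = ∑-cong h (λ a _ → cong (λ z → (+ 2 * + a - + h) * (+ 2 * + z - + h)) (*-%ˡ k a h))

  reciprocity-bound : ∀ h k .{{_ : NonZero h}} .{{_ : NonZero k}} → Coprime h k →
    3 ℕ.* (h ℕ.* h ℕ.* ∣ dedekind h k ∣)
      ℕ.≤ 3 ℕ.* (h ℕ.* h ℕ.* (k ℕ.* k)) ℕ.+ h ℕ.* k ℕ.* (h ℕ.* h ℕ.+ k ℕ.* k ℕ.+ 1)
          ℕ.+ 3 ℕ.* (k ℕ.* k ℕ.* ∣ dedekind k h ∣)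
  reciprocity-bound h k c = begin
    3 ℕ.* (h ℕ.* h ℕ.* ∣ S ∣)
      ≡⟨ abs₃ 3 h S ⟨
    ∣ + 3 * (+ h * + h * S) ∣
      ≡⟨ cong ∣_∣ (trans (isolate (+ h * + h * S) (+ k * + k * S')) (cong (_- + 3 * (+ k * + k * S')) (reciprocity h k c))) ⟩
    ∣ main - + 3 * (+ k * + k * S') ∣
      ≤⟨ ℤₚ.∣i-j∣≤∣i∣+∣j∣ main (+ 3 * (+ k * + k * S')) ⟩
    ∣ main ∣ ℕ.+ ∣ + 3 * (+ k * + k * S') ∣
      ≡⟨ cong₂ ℕ._+_ (cong ∣_∣ (sym cast)) (abs₃ 3 k S') ⟩
    3 ℕ.* (h ℕ.* h ℕ.* (k ℕ.* k)) ℕ.+ h ℕ.* k ℕ.* (h ℕ.* h ℕ.+ k ℕ.* k ℕ.+ 1) ℕ.+ 3 ℕ.* (k ℕ.* k ℕ.* ∣ S' ∣) ∎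
    where
    open ℕₚ.≤-Reasoning
    S S' main : ℤ
    S = dedekind h k
    S' = dedekind k h
    main = + 3 * (+ h * + h * (+ k * + k)) + + h * + k * (+ h * + h + + k * + k + 1ℤ)
    abs₃ : ∀ c h S → ∣ + c * (+ h * + h * S) ∣ ≡ c ℕ.* (h ℕ.* h ℕ.* ∣ S ∣)
    abs₃ c h S = trans (ℤₚ.abs-* (+ c) (+ h * + h * S)) (cong (c ℕ.*_)
      (trans (ℤₚ.abs-* (+ h * + h) S) (cong (ℕ._* ∣ S ∣) (ℤₚ.abs-* (+ h) (+ h)))))
    isolate : ∀ x y → + 3 * x ≡ + 3 * (x + y) - + 3 * y
    isolate = ℤ-Ring.solve-∀
    cast : + (3 ℕ.* (h ℕ.* h ℕ.* (k ℕ.* k)) ℕ.+ h ℕ.* k ℕ.* (h ℕ.* h ℕ.+ k ℕ.* k ℕ.+ 1)) ≡ main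
    cast = cong₂ _+_
      (trans (ℤₚ.pos-* 3 (h ℕ.* h ℕ.* (k ℕ.* k))) (cong (+ 3 *_) (trans (ℤₚ.pos-* (h ℕ.* h) (k ℕ.* k)) (cong₂ _*_ (ℤₚ.pos-* h h) (ℤₚ.pos-* k k)))))
      (trans (ℤₚ.pos-* (h ℕ.* k) (h ℕ.* h ℕ.+ k ℕ.* k ℕ.+ 1)) (cong₂ _*_ (ℤₚ.pos-* h k)
        (cong (_+ 1ℤ) (cong₂ _+_ (ℤₚ.pos-* h h) (ℤₚ.pos-* k k)))))

  -- Reciprocity passes from modulus `k` to modulus `h`, and periodicity then reduces `k` to
  -- `k % h`. Divided by the square of the modulus, the recursive term is at most `W`; everything
  -- else is absorbed by the partial quotient `a = k / h`, because `1 ≤ a` and `k ≤ 2 a h`.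
  dedekind-step : ∀ h k W .{{_ : NonZero h}} .{{_ : NonZero k}} → Coprime h k → h ℕ.≤ k →
    ∣ dedekind (k % h) h ∣ ℕ.≤ h ℕ.* h ℕ.* W →
    ∣ dedekind h k ∣ ℕ.≤ k ℕ.* k ℕ.* (W ℕ.+ 3 ℕ.* (k / h))
  dedekind-step h k W c h≤k bound =
    ℕₚ.*-cancelˡ-≤ (3 ℕ.* (h ℕ.* h)) {{ℕₚ.m*n≢0 3 (h ℕ.* h) {{_}} {{ℕₚ.m*n≢0 h h}}}} (begin
      3 ℕ.* (h ℕ.* h) ℕ.* ∣ dedekind h k ∣
        ≡⟨ ℕₚ.*-assoc 3 (h ℕ.* h) _ ⟩
      3 ℕ.* (h ℕ.* h ℕ.* ∣ dedekind h k ∣)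
        ≤⟨ reciprocity-bound h k c ⟩
      3 ℕ.* (h ℕ.* h ℕ.* (k ℕ.* k)) ℕ.+ h ℕ.* k ℕ.* (h ℕ.* h ℕ.+ k ℕ.* k ℕ.+ 1) ℕ.+ 3 ℕ.* (k ℕ.* k ℕ.* ∣ dedekind k h ∣)
        ≤⟨ ℕₚ.+-mono-≤ (ℕₚ.+-mono-≤ (ℕₚ.*-monoʳ-≤ 3 hhkk≤) (ℕₚ.*-monoʳ-≤ (h ℕ.* k) squares≤))
             (ℕₚ.*-monoʳ-≤ 3 (ℕₚ.*-monoʳ-≤ (k ℕ.* k) (subst (λ z → ∣ z ∣ ℕ.≤ h ℕ.* h ℕ.* W) (dedekind-% h k) bound))) ⟩
      3 ℕ.* (h ℕ.* h ℕ.* (k ℕ.* k) ℕ.* a) ℕ.+ h ℕ.* k ℕ.* (h ℕ.* k ℕ.* a ℕ.+ k ℕ.* ((a ℕ.+ a) ℕ.* h) ℕ.+ h ℕ.* k ℕ.* a)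
          ℕ.+ 3 ℕ.* (k ℕ.* k ℕ.* (h ℕ.* h ℕ.* W))
        -- Apart from the term with `W`, the bound is `3 + 4 = 7` copies of `h * h * (k * k) * a`;
        -- two more complete the nine required by `3 * 3 a`.
        ≤⟨ ℕₚ.m≤m+n _ (2 ℕ.* (h ℕ.* h ℕ.* (k ℕ.* k) ℕ.* a)) ⟩
      3 ℕ.* (h ℕ.* h ℕ.* (k ℕ.* k) ℕ.* a) ℕ.+ h ℕ.* k ℕ.* (h ℕ.* k ℕ.* a ℕ.+ k ℕ.* ((a ℕ.+ a) ℕ.* h) ℕ.+ h ℕ.* k ℕ.* a)
          ℕ.+ 3 ℕ.* (k ℕ.* k ℕ.* (h ℕ.* h ℕ.* W)) ℕ.+ 2 ℕ.* (h ℕ.* h ℕ.* (k ℕ.* k) ℕ.* a)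
        ≡⟨ collect h k a W ⟩
      3 ℕ.* (h ℕ.* h) ℕ.* (k ℕ.* k ℕ.* (W ℕ.+ 3 ℕ.* a)) ∎)
    where
    open ℕₚ.≤-Reasoning
    a : ℕ
    a = k / h
    1≤a : 1 ℕ.≤ a
    1≤a = m≥n⇒m/n>0 h≤k
    grow : ∀ x → x ℕ.≤ x ℕ.* a
    grow x = ℕₚ.≤-trans (ℕₚ.≤-reflexive (sym (ℕₚ.*-identityʳ x))) (ℕₚ.*-monoʳ-≤ x 1≤a)
    hhkk≤ : h ℕ.* h ℕ.* (k ℕ.* k) ℕ.≤ h ℕ.* h ℕ.* (k ℕ.* k) ℕ.* a
    hhkk≤ = grow _
    k≤2ah : k ℕ.≤ (a ℕ.+ a) ℕ.* h
    k≤2ah = begin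
      k                            ≡⟨ m≡m%n+[m/n]*n k h ⟩
      k % h ℕ.+ a ℕ.* h            ≤⟨ ℕₚ.+-monoˡ-≤ (a ℕ.* h) (ℕₚ.<⇒≤ (m%n<n k h)) ⟩
      h ℕ.+ a ℕ.* h                ≤⟨ ℕₚ.+-monoˡ-≤ (a ℕ.* h) (ℕₚ.≤-trans (grow h) (ℕₚ.≤-reflexive (ℕₚ.*-comm h a))) ⟩
      a ℕ.* h ℕ.+ a ℕ.* h          ≡⟨ ℕₚ.*-distribʳ-+ h a a ⟨
      (a ℕ.+ a) ℕ.* h              ∎
    squares≤ : h ℕ.* h ℕ.+ k ℕ.* k ℕ.+ 1 ℕ.≤ h ℕ.* k ℕ.* a ℕ.+ k ℕ.* ((a ℕ.+ a) ℕ.* h) ℕ.+ h ℕ.* k ℕ.* a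
    squares≤ = ℕₚ.+-mono-≤ (ℕₚ.+-mono-≤ (ℕₚ.≤-trans (ℕₚ.*-monoʳ-≤ h h≤k) (grow _)) (ℕₚ.*-monoʳ-≤ k k≤2ah))
                           (ℕₚ.≤-trans (ℕ.>-nonZero⁻¹ (h ℕ.* k) {{ℕₚ.m*n≢0 h k}}) (grow _))
    collect : ∀ h k a W →
      3 ℕ.* (h ℕ.* h ℕ.* (k ℕ.* k) ℕ.* a) ℕ.+ h ℕ.* k ℕ.* (h ℕ.* k ℕ.* a ℕ.+ k ℕ.* ((a ℕ.+ a) ℕ.* h) ℕ.+ h ℕ.* k ℕ.* a)
          ℕ.+ 3 ℕ.* (k ℕ.* k ℕ.* (h ℕ.* h ℕ.* W)) ℕ.+ 2 ℕ.* (h ℕ.* h ℕ.* (k ℕ.* k) ℕ.* a)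
      ≡ 3 ℕ.* (h ℕ.* h) ℕ.* (k ℕ.* k ℕ.* (W ℕ.+ 3 ℕ.* a))
    collect = ℕ-Ring.solve-∀

  -- Division with a default value, and harmonic sums.

  infixl 7 _÷_
  -- The value 0 at divisor 0 lets sums of quotients run over full residue systems: the zero residue
  -- contributes nothing.
  _÷_ : ℕ → ℕ → ℕ
  m ÷ zero  = 0
  m ÷ suc n = m / suc n

  ≤÷ : ∀ {a m n} .{{_ : NonZero n}} → a ℕ.* n ℕ.≤ m → a ℕ.≤ m ÷ n
  ≤÷ {a} {m} {suc n} le = subst (ℕ._≤ m / suc n) (m*n/n≡m a (suc n)) (/-monoˡ-≤ (suc n) le)

  ÷-*-assoc : ∀ m n o → m ÷ (n ℕ.* o) ≡ m ÷ n ÷ o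
  ÷-*-assoc m zero    zero    = refl
  ÷-*-assoc m zero    (suc o) = sym (0/n≡0 (suc o))
  ÷-*-assoc m (suc n) zero    = cong (m ÷_) (ℕₚ.*-zeroʳ (suc n))
  ÷-*-assoc m (suc n) (suc o) = sym (m/n/o≡m/[n*o] m (suc n) (suc o))

  ÷*≤ : ∀ m n → n ℕ.* (m ÷ n) ℕ.≤ m
  ÷*≤ m zero    = z≤n
  ÷*≤ m (suc n) = ℕₚ.≤-trans (ℕₚ.≤-reflexive (ℕₚ.*-comm (suc n) (m / suc n))) (m/n*n≤m m (suc n))

  ÷-antitone : ∀ m {n o} .{{_ : NonZero n}} → n ℕ.≤ o → m ÷ o ℕ.≤ m ÷ n
  ÷-antitone m {suc n} {suc o} n≤o = /-monoʳ-≤ m n≤o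

  -- Dyadic blocks: passing from `2 ^ L` to `2 ^ suc L` adds `2 ^ L` terms, each at most
  -- `M ÷ 2 ^ L`, hence at most `M` in total. For `L = 0` the only index is 0, where the quotient is
  -- 0 by default.
  harmonic-bound : ∀ M L → ℕΣ.∑ (2 ℕ.^ L) (M ÷_) ℕ.≤ M ℕ.* L
  harmonic-bound M zero    = z≤n
  harmonic-bound M (suc L) = begin
    ℕΣ.∑ (N ℕ.+ (N ℕ.+ 0)) (M ÷_)                              ≡⟨ cong (λ z → ℕΣ.∑ (N ℕ.+ z) (M ÷_)) (ℕₚ.+-identityʳ N) ⟩
    ℕΣ.∑ (N ℕ.+ N) (M ÷_)                                      ≡⟨ ℕΣ.∑-split N N (M ÷_) ⟩
    ℕΣ.∑ N (M ÷_) ℕ.+ ℕΣ.∑ N (λ i → M ÷ (N ℕ.+ i))             ≤⟨ ℕₚ.+-mono-≤ (harmonic-bound M L)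
                                                                   (∑ᴺ-mono N (λ i _ → ÷-antitone M {{ℕₚ.m^n≢0 2 L}} (ℕₚ.m≤m+n N i))) ⟩
    M ℕ.* L ℕ.+ ℕΣ.∑ N (λ _ → M ÷ N)                           ≡⟨ cong (M ℕ.* L ℕ.+_) (∑ᴺ-const N (M ÷ N)) ⟩
    M ℕ.* L ℕ.+ N ℕ.* (M ÷ N)                                  ≤⟨ ℕₚ.+-monoʳ-≤ (M ℕ.* L) (÷*≤ M N) ⟩
    M ℕ.* L ℕ.+ M                                              ≡⟨ trans (ℕₚ.+-comm (M ℕ.* L) M) (sym (ℕₚ.*-suc M L)) ⟩
    M ℕ.* suc L                                                ∎
    where
    open ℕₚ.≤-Reasoning
    N = 2 ℕ.^ L

  -- Partial quotients along the Euclidean algorithm.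

  module Euclid (p : ℕ) .{{_ : NonZero p}} where

    infix 4 _≡ₚ_
    -- The quotient is an integer, so that congruences between natural numbers can be subtracted
    -- from each other.
    _≡ₚ_ : ℕ → ℕ → Set
    x ≡ₚ y = ∃[ u ] + x ≡ + y + u * + p

    ≡ₚ⇒% : ∀ {x y} → y ℕ.< p → x ≡ₚ y → x % p ≡ y
    ≡ₚ⇒% {x} {y} y<p (+ u , eq) = begin
      x % p                    ≡⟨ cong (_% p) (ℤₚ.+-injective (trans eq (cong (λ z → + y + z) (sym (ℤₚ.pos-* u p))))) ⟩
      (y ℕ.+ u ℕ.* p) % p      ≡⟨ [m+kn]%n≡m%n y u p ⟩
      y % p                    ≡⟨ m<n⇒m%n≡m y<p ⟩
      y                        ∎
      where open ≡-Reasoning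
    -- A negative quotient would give `y = x + suc u * p`, which is at least `p`.
    ≡ₚ⇒% {x} {y} y<p (-[1+ u ] , eq) = contradiction y<p (ℕₚ.≤⇒≯ (ℕₚ.≤-trans
        (ℕₚ.≤-trans (ℕₚ.m≤m+n p (u ℕ.* p)) (ℕₚ.m≤n+m _ x)) (ℕₚ.≤-reflexive x+up≡y)))
      where
      move : ∀ x y u p → x ≡ y + - u * p → x + u * p ≡ y
      move x y u p refl = cancel y u p
        where
        cancel : ∀ y u p → y + - u * p + u * p ≡ y
        cancel = ℤ-Ring.solve-∀
      x+up≡y : x ℕ.+ suc u ℕ.* p ≡ y
      x+up≡y = ℤₚ.+-injective (trans (cong (λ z → + x + z) (ℤₚ.pos-* (suc u) p)) (move (+ x) (+ y) (+ suc u) (+ p) eq))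

    -- If t is the denominator of a convergent of η / p then g η t bounds the next partial quotient.
    g : ℕ → ℕ → ℕ
    g η t = p ÷ (t ℕ.* (t ℕ.* η % p))

    -- The terms not yet spent. For each of `η` and `η'` the denominators that occur increase
    -- strictly, so every `g η t` pays for at most one partial quotient.
    from : (ℕ → ℕ) → ℕ → ℕ
    from w q = ℕΣ.∑ (p ℕ.∸ q) (λ i → w (q ℕ.+ i))

    from-step : ∀ w {q} → q ℕ.< p → from w q ≡ w q ℕ.+ from w (suc q)
    from-step w {q} q<p = begin
      ℕΣ.∑ (p ℕ.∸ q) (λ i → w (q ℕ.+ i))                   ≡⟨ cong (λ z → ℕΣ.∑ z (λ i → w (q ℕ.+ i))) (ℕₚ.+-∸-assoc 1 q<p) ⟩
      w (q ℕ.+ 0) ℕ.+ ℕΣ.∑ (p ℕ.∸ suc q) (λ i → w (q ℕ.+ suc i))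
        ≡⟨ cong₂ ℕ._+_ (cong w (ℕₚ.+-identityʳ q)) (ℕΣ.∑-cong (p ℕ.∸ suc q) (λ i _ → cong w (ℕₚ.+-suc q i))) ⟩
      w q ℕ.+ from w (suc q)                               ∎
      where open ≡-Reasoning

    from-suc : ∀ w q → from w (suc q) ℕ.≤ from w q
    from-suc w q with q ℕ.<? p
    ... | yes q<p = ℕₚ.≤-trans (ℕₚ.m≤n+m _ (w q)) (ℕₚ.≤-reflexive (sym (from-step w q<p)))
    ... | no  q≮p = ℕₚ.≤-trans (ℕₚ.≤-reflexive (cong (λ z → ℕΣ.∑ z (λ i → w (suc q ℕ.+ i)))
                       (ℕₚ.m≤n⇒m∸n≡0 (ℕₚ.m≤n⇒m≤1+n (ℕₚ.≮⇒≥ q≮p))))) z≤n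

    from-antitone : ∀ w {q q'} → q ℕ.≤ q' → from w q' ℕ.≤ from w q
    from-antitone w q≤q' = go (ℕₚ.≤⇒≤′ q≤q')
      where
      go : ∀ {q q'} → q ℕ.≤′ q' → from w q' ℕ.≤ from w q
      go ℕ.≤′-refl       = ℕₚ.≤-refl
      go (ℕ.≤′-step {n} l) = ℕₚ.≤-trans (from-suc w n) (go l)

    -- (k , h) are consecutive remainders of the Euclidean algorithm and q , q' the
    -- denominators of the corresponding convergents; η and η' ≡ - η take turns, which
    -- accounts for the alternating signs in q η ≡ ± h.
    euclid-bound : ∀ {h k q q' η η'} w .{{_ : NonZero k}} → Acc ℕ._<_ h → Coprime h k → h ℕ.< k → 1 ℕ.≤ q →
      q ℕ.* k ℕ.+ q' ℕ.* h ≡ p → + η + + η' ≡ w * + p → q ℕ.* η ≡ₚ h → q' ℕ.* η' ≡ₚ k →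
      ∣ dedekind h k ∣ ℕ.≤ k ℕ.* k ℕ.* (1 ℕ.+ 3 ℕ.* (from (g η) q ℕ.+ from (g η') (suc q')))
    -- The algorithm has ended: coprimality forces `k = 1`, the Dedekind sum is 1, and the constant
    -- 1 of the bound covers it.
    euclid-bound {zero} w _ c h<k 1≤q eq opp e e' with 0-coprimeTo-m⇒m≡1 c
    ... | refl = s≤s z≤n
    euclid-bound {h@(suc _)} {k} {q} {q'} {η} {η'} w (acc rec) c h<k 1≤q eq opp (u , e) (v , e') = begin
      ∣ dedekind h k ∣
        ≤⟨ dedekind-step h k _ c (ℕₚ.<⇒≤ h<k)
             (euclid-bound {r} {h} {q₁} {q} {η'} {η} w (rec r<h) c' r<h 1≤q₁ eq₁ (trans (ℤₚ.+-comm (+ η') (+ η)) opp) e₁ (u , e)) ⟩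
      k ℕ.* k ℕ.* (1 ℕ.+ 3 ℕ.* (from (g η') q₁ ℕ.+ from (g η) (suc q)) ℕ.+ 3 ℕ.* a)
        -- The new partial quotient `a` is charged to the term at `q`, which the tail
        -- `from (g η) (suc q)` of the recursive bound leaves free.
        ≤⟨ ℕₚ.*-monoʳ-≤ (k ℕ.* k) (ℕₚ.+-mono-≤ (ℕₚ.+-monoʳ-≤ 1 (ℕₚ.*-monoʳ-≤ 3 (ℕₚ.+-monoˡ-≤ _ (from-antitone (g η') q'<q₁))))
                                                (ℕₚ.*-monoʳ-≤ 3 a≤g)) ⟩
      k ℕ.* k ℕ.* (1 ℕ.+ 3 ℕ.* (from (g η') (suc q') ℕ.+ from (g η) (suc q)) ℕ.+ 3 ℕ.* g η q)
        ≡⟨ cong (k ℕ.* k ℕ.*_) (collect (from (g η') (suc q')) (from (g η) (suc q)) (g η q)) ⟩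
      k ℕ.* k ℕ.* (1 ℕ.+ 3 ℕ.* (g η q ℕ.+ from (g η) (suc q) ℕ.+ from (g η') (suc q')))
        ≡⟨ cong (λ z → k ℕ.* k ℕ.* (1 ℕ.+ 3 ℕ.* (z ℕ.+ from (g η') (suc q')))) (from-step (g η) q<p) ⟨
      k ℕ.* k ℕ.* (1 ℕ.+ 3 ℕ.* (from (g η) q ℕ.+ from (g η') (suc q'))) ∎
      where
      open ℕₚ.≤-Reasoning
      a r q₁ : ℕ
      a = k / h
      r = k % h
      q₁ = a ℕ.* q ℕ.+ q'
      r<h : r ℕ.< h
      r<h = m%n<n k h
      k≡ : k ≡ r ℕ.+ a ℕ.* h
      k≡ = m≡m%n+[m/n]*n k h
      1≤a : 1 ℕ.≤ a
      1≤a = m≥n⇒m/n>0 (ℕₚ.<⇒≤ h<k)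
      1≤aq : 1 ℕ.≤ a ℕ.* q
      1≤aq = ℕₚ.*-mono-≤ 1≤a 1≤q
      q'<q₁ : suc q' ℕ.≤ q₁
      q'<q₁ = ℕₚ.+-monoˡ-≤ q' 1≤aq
      1≤q₁ : 1 ℕ.≤ q₁
      1≤q₁ = ℕₚ.≤-trans 1≤aq (ℕₚ.m≤m+n _ q')
      c' : Coprime r h
      c' (d∣r , d∣h) = c (d∣h , subst (_ ∣_) (sym k≡) (∣m∣n⇒∣m+n d∣r (∣n⇒∣m*n a d∣h)))
      eq₁ : q₁ ℕ.* h ℕ.+ q ℕ.* r ≡ p
      eq₁ = trans (trans (poly a q q' h r) (cong (λ z → q ℕ.* z ℕ.+ q' ℕ.* h) (sym k≡))) eq
        where
        poly : ∀ a q q' h r → (a ℕ.* q ℕ.+ q') ℕ.* h ℕ.+ q ℕ.* r ≡ q ℕ.* (r ℕ.+ a ℕ.* h) ℕ.+ q' ℕ.* h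
        poly = ℕ-Ring.solve-∀
      qk≤p : q ℕ.* k ℕ.≤ p
      qk≤p = ℕₚ.≤-trans (ℕₚ.m≤m+n _ _) (ℕₚ.≤-reflexive eq)
      1<k : 1 ℕ.< k
      1<k = ℕₚ.≤-trans (s≤s (s≤s z≤n)) h<k
      q<p : q ℕ.< p
      q<p = ℕₚ.<-≤-trans (ℕₚ.m<m*n q k {{ℕ.>-nonZero 1≤q}} 1<k) qk≤p
      h<p : h ℕ.< p
      h<p = ℕₚ.<-≤-trans h<k (ℕₚ.≤-trans (ℕₚ.m≤n*m k q {{ℕ.>-nonZero 1≤q}}) qk≤p)
      -- The residue of `q * η` is `h`, and `a * h ≤ k` together with the invariant
      -- `q * k + q' * h = p` gives `a * (q * h) ≤ p`.
      a≤g : a ℕ.≤ g η q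
      a≤g = subst (λ z → a ℕ.≤ p ÷ (q ℕ.* z)) (sym (≡ₚ⇒% h<p (u , e)))
        (≤÷ {{ℕₚ.m*n≢0 q h {{ℕ.>-nonZero 1≤q}}}} (begin
          a ℕ.* (q ℕ.* h)   ≡⟨ poly a q h ⟩
          q ℕ.* (a ℕ.* h)   ≤⟨ ℕₚ.*-monoʳ-≤ q (m/n*n≤m k h) ⟩
          q ℕ.* k           ≤⟨ qk≤p ⟩
          p                 ∎))
        where
        poly : ∀ a q h → a ℕ.* (q ℕ.* h) ≡ q ℕ.* (a ℕ.* h)
        poly = ℕ-Ring.solve-∀
      collect : ∀ x y z → 1 ℕ.+ 3 ℕ.* (x ℕ.+ y) ℕ.+ 3 ℕ.* z ≡ 1 ℕ.+ 3 ℕ.* (z ℕ.+ y ℕ.+ x)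
      collect = ℕ-Ring.solve-∀
      -- Modulo `p`, `a q η' + q' η'` is `- a h + k`, as `η'` is congruent to `- η`; and this is the
      -- next remainder `r`.
      q₁η'≡ : + (q₁ ℕ.* η') ≡ + r + (+ a * + q * w - + a * u + v) * + p
      q₁η'≡ = R.begin
        + (q₁ ℕ.* η')
          R.≡⟨ trans (ℤₚ.pos-* q₁ η') (cong (λ z → (z + + q') * + η') (ℤₚ.pos-* a q)) ⟩
        (+ a * + q + + q') * + η'
          R.≡⟨ spread (+ a) (+ q) (+ q') (+ η) (+ η') ⟩
        + a * + q * (+ η + + η') - + a * (+ q * + η) + + q' * + η'
          R.≡⟨ cong₂ (λ x y → + a * + q * x - + a * y + + q' * + η') opp (trans (sym (ℤₚ.pos-* q η)) e) ⟩
        + a * + q * (w * + p) - + a * (+ h + u * + p) + + q' * + η'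
          R.≡⟨ cong (λ z → + a * + q * (w * + p) - + a * (+ h + u * + p) + z)
               (trans (sym (ℤₚ.pos-* q' η')) (trans e' (cong (_+ v * + p) (trans (cong +_ k≡) (cong (λ z → + r + z) (ℤₚ.pos-* a h)))))) ⟩
        + a * + q * (w * + p) - + a * (+ h + u * + p) + (+ r + + a * + h + v * + p)
          R.≡⟨ gather (+ a) (+ q) w (+ p) (+ h) u (+ r) v ⟩
        + r + (+ a * + q * w - + a * u + v) * + p R.∎
        where
        module R = ≡-Reasoning
        spread : ∀ a q q' η η' → (a * q + q') * η' ≡ a * q * (η + η') - a * (q * η) + q' * η'
        spread = ℤ-Ring.solve-∀
        gather : ∀ a q w p h u r v → a * q * (w * p) - a * (h + u * p) + (r + a * h + v * p)
                                   ≡ r + (a * q * w - a * u + v) * p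
        gather = ℤ-Ring.solve-∀
      e₁ : q₁ ℕ.* η' ≡ₚ r
      e₁ = + a * + q * w - + a * u + v , q₁η'≡

  -- Dedekind sums on average over `h`, and rows of correlations.

  module RowSum (p : ℕ) .{{_ : NonZero p}} (pr : Prime p) (L : ℕ) (p≤2^L : p ℕ.≤ 2 ℕ.^ L) where
    open Euclid p

    1<p : 1 ℕ.< p
    1<p = ℕ.nonTrivial⇒n>1 p {{prime⇒nonTrivial pr}}

    coprime-p : ∀ x .{{_ : NonZero x}} → x ℕ.< p → Coprime x p
    coprime-p x x<p = Coprime.sym (prime⇒coprime pr x<p)

    coprime-p-1 : Coprime (p ℕ.∸ 1) p
    coprime-p-1 = coprime-p (p ℕ.∸ 1) {{ℕ.>-nonZero (ℕₚ.m<n⇒0<n∸m 1<p)}} (ℕₚ.∸-monoʳ-< z<s (ℕₚ.<⇒≤ 1<p))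

    saw-0 : saw p 0 ≡ - + p
    saw-0 = trans (cong (λ z → + 2 * + z - + p) (m<n⇒m%n≡m (ℕₚ.<⇒≤ 1<p))) (ℤₚ.+-identityˡ (- + p))

    -- The nonzero residues cancel in pairs `a`, `p - a`; what is left is the value `- p` at 0.
    ∑-saw : ∑ p (λ a → + 2 * + a - + p) ≡ - + p
    ∑-saw = begin
      ∑ p (λ a → + 2 * + a - + p)
        ≡⟨ ∑-expand p ((+ 2 , (+_)) ∷ (- + p , (λ _ → 1ℤ)) ∷ []) (λ a → shape (+ a) (+ p)) ⟩
      + 2 * ∑ p (+_) + (- + p * ∑ p (λ _ → 1ℤ) + 0ℤ)
        ≡⟨ cong₂ (λ x y → x + (- + p * y + 0ℤ)) (∑-linear p) (∑-const p 1ℤ) ⟩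
      + p * (+ p - 1ℤ) + (- + p * (+ p * 1ℤ) + 0ℤ)
        ≡⟨ simplify (+ p) ⟩
      - + p ∎
      where
      open ≡-Reasoning
      shape : ∀ a p → + 2 * a - p ≡ + 2 * a + (- p * 1ℤ + 0ℤ)
      shape = ℤ-Ring.solve-∀
      simplify : ∀ p → p * (p - 1ℤ) + (- p * (p * 1ℤ) + 0ℤ) ≡ - p
      simplify = ℤ-Ring.solve-∀

    dedekind-0 : dedekind 0 p ≡ + p * + p
    dedekind-0 = begin
      ∑ p (λ a → (+ 2 * + a - + p) * saw p 0)   ≡⟨ ∑-*ʳ p (saw p 0) (λ a → + 2 * + a - + p) ⟩
      ∑ p (λ a → + 2 * + a - + p) * saw p 0     ≡⟨ cong₂ _*_ ∑-saw saw-0 ⟩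
      - + p * - + p                             ≡⟨ neg-neg (+ p) ⟩
      + p * + p                                 ∎
      where
      open ≡-Reasoning
      neg-neg : ∀ p → - p * - p ≡ p * p
      neg-neg = ℤ-Ring.solve-∀

    G : ℕ → ℕ
    G η = ℕΣ.∑ p (g η)

    -- The algorithm starts from the remainders `p`, `h` and the denominators 1, 0, with
    -- `(p ∸ 1) * h` in the role of `- h`; the tails are then enlarged to full sums. `h = 0` is not
    -- coprime to `p` and is computed directly.
    dedekind-bound : ∀ h → h ℕ.< p → ∣ dedekind h p ∣ ℕ.≤ p ℕ.* p ℕ.* (1 ℕ.+ 3 ℕ.* (G h ℕ.+ G ((p ℕ.∸ 1) ℕ.* h)))
    dedekind-bound zero _ = ℕₚ.≤-trans
      (ℕₚ.≤-reflexive (trans (cong ∣_∣ dedekind-0) (trans (ℤₚ.abs-* (+ p) (+ p)) (sym (ℕₚ.*-identityʳ (p ℕ.* p))))))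
      (ℕₚ.*-monoʳ-≤ (p ℕ.* p) (s≤s z≤n))
    dedekind-bound h@(suc _) h<p = ℕₚ.≤-trans
      (euclid-bound {h} {p} {1} {0} {h} {(p ℕ.∸ 1) ℕ.* h} (+ h) (<-wellFounded h) (coprime-p h h<p) h<p (s≤s z≤n)
        (trans (ℕₚ.+-identityʳ (1 ℕ.* p)) (ℕₚ.*-identityˡ p)) opposite
        (0ℤ , cong +_ (trans (ℕₚ.*-identityˡ h) (sym (ℕₚ.+-identityʳ h))))
        (- 1ℤ , cancel (+ p)))
      (ℕₚ.*-monoʳ-≤ (p ℕ.* p) (ℕₚ.+-monoʳ-≤ 1 (ℕₚ.*-monoʳ-≤ 3
        (ℕₚ.+-mono-≤ (from-suc (g h) 0) (from-suc (g ((p ℕ.∸ 1) ℕ.* h)) 0)))))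
      where
      cancel : ∀ p → 0ℤ ≡ p + - 1ℤ * p
      cancel = ℤ-Ring.solve-∀
      opposite : + h + + ((p ℕ.∸ 1) ℕ.* h) ≡ + h * + p
      opposite = trans (cong +_ (trans (cong (ℕ._* h) (ℕₚ.suc-pred p)) (ℕₚ.*-comm p h))) (ℤₚ.pos-* h p)

    -- After exchanging the sums, `t` is fixed and `t * h` runs through all residues `r`, so
    -- `p ÷ (t * r)` is summed over independent `t` and `r`. Each of the two harmonic sums costs a
    -- factor `L`.
    ∑-G : ℕΣ.∑ p G ℕ.≤ p ℕ.* L ℕ.* L
    ∑-G = begin
      ℕΣ.∑ p (λ h → ℕΣ.∑ p (λ t → g h t))   ≡⟨ ℕΣ.∑-swap p p g ⟩
      ℕΣ.∑ p (λ t → ℕΣ.∑ p (λ h → g h t))   ≤⟨ ∑ᴺ-mono p column ⟩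
      ℕΣ.∑ p (λ t → (p ÷ t) ℕ.* L)          ≡⟨ ℕΣ.∑-*ʳ p L (p ÷_) ⟩
      ℕΣ.∑ p (p ÷_) ℕ.* L                   ≤⟨ ℕₚ.*-monoˡ-≤ L (harmonic p) ⟩
      p ℕ.* L ℕ.* L                         ∎
      where
      open ℕₚ.≤-Reasoning
      harmonic : ∀ M → ℕΣ.∑ p (M ÷_) ℕ.≤ M ℕ.* L
      harmonic M = ℕₚ.≤-trans (∑ᴺ-extend p≤2^L (M ÷_)) (harmonic-bound M L)
      column : ∀ t → t ℕ.< p → ℕΣ.∑ p (λ h → g h t) ℕ.≤ (p ÷ t) ℕ.* L
      column zero      _   = ℕₚ.≤-reflexive (ℕΣ.∑-zero p)
      column t@(suc _) t<p = begin
        ℕΣ.∑ p (λ h → p ÷ (t ℕ.* (t ℕ.* h % p)))   ≡⟨ ℕΣ.∑-dilate t (coprime-p t t<p) (λ r → p ÷ (t ℕ.* r)) ⟩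
        ℕΣ.∑ p (λ r → p ÷ (t ℕ.* r))               ≡⟨ ℕΣ.∑-cong p (λ r _ → ÷-*-assoc p t r) ⟩
        ℕΣ.∑ p (λ r → p ÷ t ÷ r)                   ≤⟨ harmonic (p ÷ t) ⟩
        (p ÷ t) ℕ.* L                              ∎

    G-% : ∀ η → G (η % p) ≡ G η
    G-% η = ℕΣ.∑-cong p (λ t _ → cong (λ z → p ÷ (t ℕ.* z)) (*-%ʳ t η p))

    -- Negation permutes the residues, so `G'` has the same total as `G`; the 6 is `3 * 2`.
    ∑-dedekind : ℕΣ.∑ p (λ h → ∣ dedekind h p ∣) ℕ.≤ p ℕ.* p ℕ.* p ℕ.* (1 ℕ.+ 6 ℕ.* (L ℕ.* L))
    ∑-dedekind = begin
      ℕΣ.∑ p (λ h → ∣ dedekind h p ∣)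
        ≤⟨ ∑ᴺ-mono p dedekind-bound ⟩
      ℕΣ.∑ p (λ h → p ℕ.* p ℕ.* (1 ℕ.+ 3 ℕ.* (G h ℕ.+ G' h)))
        ≡⟨ ℕΣ.∑-*ˡ p (p ℕ.* p) (λ h → 1 ℕ.+ 3 ℕ.* (G h ℕ.+ G' h)) ⟩
      p ℕ.* p ℕ.* ℕΣ.∑ p (λ h → 1 ℕ.+ 3 ℕ.* (G h ℕ.+ G' h))
        ≡⟨ cong (p ℕ.* p ℕ.*_) (trans (ℕΣ.∑-+ p (λ _ → 1) (λ h → 3 ℕ.* (G h ℕ.+ G' h))) (cong₂ ℕ._+_ (∑ᴺ-const p 1)
             (trans (ℕΣ.∑-*ˡ p 3 (λ h → G h ℕ.+ G' h)) (cong (3 ℕ.*_) (trans (ℕΣ.∑-+ p G G') (cong (ℕΣ.∑ p G ℕ.+_) ∑-G')))))) ⟩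
      p ℕ.* p ℕ.* (p ℕ.* 1 ℕ.+ 3 ℕ.* (ℕΣ.∑ p G ℕ.+ ℕΣ.∑ p G))
        ≤⟨ ℕₚ.*-monoʳ-≤ (p ℕ.* p) (ℕₚ.+-monoʳ-≤ (p ℕ.* 1) (ℕₚ.*-monoʳ-≤ 3 (ℕₚ.+-mono-≤ ∑-G ∑-G))) ⟩
      p ℕ.* p ℕ.* (p ℕ.* 1 ℕ.+ 3 ℕ.* (p ℕ.* L ℕ.* L ℕ.+ p ℕ.* L ℕ.* L))
        ≡⟨ collect p L ⟩
      p ℕ.* p ℕ.* p ℕ.* (1 ℕ.+ 6 ℕ.* (L ℕ.* L)) ∎
      where
      open ℕₚ.≤-Reasoning
      G' : ℕ → ℕ
      G' h = G ((p ℕ.∸ 1) ℕ.* h)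
      ∑-G' : ℕΣ.∑ p G' ≡ ℕΣ.∑ p G
      ∑-G' = trans (ℕΣ.∑-cong p (λ h _ → sym (G-% ((p ℕ.∸ 1) ℕ.* h)))) (ℕΣ.∑-dilate (p ℕ.∸ 1) coprime-p-1 G)
      collect : ∀ p L → p ℕ.* p ℕ.* (p ℕ.* 1 ℕ.+ 3 ℕ.* (p ℕ.* L ℕ.* L ℕ.+ p ℕ.* L ℕ.* L))
                      ≡ p ℕ.* p ℕ.* p ℕ.* (1 ℕ.+ 6 ℕ.* (L ℕ.* L))
      collect = ℕ-Ring.solve-∀

    correlation : ℕ → ℕ → ℤ
    correlation x y = ∑ p (λ a → saw p (a ℕ.* x) * saw p (a ℕ.* y))

    saw-cong : ∀ {s t} → s % p ≡ t % p → saw p s ≡ saw p t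
    saw-cong = cong (λ z → + 2 * + z - + p)

    -- Substituting `b = a * x`, a permutation of the multipliers as `x` is a unit, turns
    -- `saw p (a * x)` into `2 b - p` and the other factor into `saw p (h * b)`.
    correlation-dedekind : ∀ x h .{{_ : NonZero x}} → x ℕ.< p → correlation x (x ℕ.* h % p) ≡ dedekind h p
    correlation-dedekind x h x<p = trans
      (∑-cong p (λ a _ → cong₂ _*_ (saw-cong (cong (_% p) (ℕₚ.*-comm a x))) (saw-cong (residues a))))
      (∑-dilate x (coprime-p x x<p) (λ b → (+ 2 * + b - + p) * saw p (h ℕ.* b)))
      where
      residues : ∀ a → (a ℕ.* (x ℕ.* h % p)) % p ≡ (h ℕ.* (x ℕ.* a % p)) % p
      residues a = trans (*-%ʳ a (x ℕ.* h) p) (trans (cong (_% p) (poly a x h)) (sym (*-%ʳ h (x ℕ.* a) p)))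
        where
        poly : ∀ a x h → a ℕ.* (x ℕ.* h) ≡ h ℕ.* (x ℕ.* a)
        poly = ℕ-Ring.solve-∀

    -- Since 0 is not a unit, the symmetry of the correlation is used: `y` is the unit and `h = 0`.
    correlation-0 : ∀ y .{{_ : NonZero y}} → y ℕ.< p → correlation 0 y ≡ + p * + p
    correlation-0 y y<p = begin
      correlation 0 y                 ≡⟨ ∑-cong p (λ a _ → ℤₚ.*-comm (saw p (a ℕ.* 0)) (saw p (a ℕ.* y))) ⟩
      correlation y 0                 ≡⟨ cong (correlation y) (sym (trans (cong (_% p) (ℕₚ.*-zeroʳ y)) (m<n⇒m%n≡m (ℕₚ.<⇒≤ 1<p)))) ⟩
      correlation y (y ℕ.* 0 % p)     ≡⟨ correlation-dedekind y 0 y<p ⟩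
      dedekind 0 p                    ≡⟨ dedekind-0 ⟩
      + p * + p                       ∎
      where open ≡-Reasoning

    correlation-0-0 : correlation 0 0 ≡ + p * (+ p * + p)
    correlation-0-0 = trans (∑-cong p (λ a _ → trans (cong (λ z → z * z) (trans (cong (saw p) (ℕₚ.*-zeroʳ a)) saw-0)) (neg-neg (+ p))))
                            (∑-const p (+ p * + p))
      where
      neg-neg : ∀ p → - p * - p ≡ p * p
      neg-neg = ℤ-Ring.solve-∀

    -- For a unit `x`, writing `y = x * h` makes the row run through every Dedekind sum modulo `p`
    -- once. In row 0 the diagonal entry is the cube of `p` and the others are its square, which
    -- accounts for the 2.
    row-bound : ∀ x → x ℕ.< p → ℕΣ.∑ p (λ y → ∣ correlation x y ∣) ℕ.≤ p ℕ.* p ℕ.* p ℕ.* (2 ℕ.+ 6 ℕ.* (L ℕ.* L))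
    row-bound zero _ = begin
      ℕΣ.∑ p (λ y → ∣ correlation 0 y ∣)
        ≤⟨ peel p (λ y → ∣ correlation 0 y ∣) bound ⟩
      ∣ correlation 0 0 ∣ ℕ.+ p ℕ.* (p ℕ.* p)
        ≡⟨ cong (ℕ._+ p ℕ.* (p ℕ.* p)) (trans (cong ∣_∣ correlation-0-0) (trans (ℤₚ.abs-* (+ p) (+ p * + p)) (cong (p ℕ.*_) (ℤₚ.abs-* (+ p) (+ p))))) ⟩
      p ℕ.* (p ℕ.* p) ℕ.+ p ℕ.* (p ℕ.* p)
        ≤⟨ ℕₚ.m≤m+n _ (p ℕ.* p ℕ.* p ℕ.* (6 ℕ.* (L ℕ.* L))) ⟩
      p ℕ.* (p ℕ.* p) ℕ.+ p ℕ.* (p ℕ.* p) ℕ.+ p ℕ.* p ℕ.* p ℕ.* (6 ℕ.* (L ℕ.* L))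
        ≡⟨ collect p (6 ℕ.* (L ℕ.* L)) ⟩
      p ℕ.* p ℕ.* p ℕ.* (2 ℕ.+ 6 ℕ.* (L ℕ.* L)) ∎
      where
      open ℕₚ.≤-Reasoning
      peel : ∀ n f {c} → (∀ y → suc y ℕ.< n → f (suc y) ℕ.≤ c) → ℕΣ.∑ n f ℕ.≤ f 0 ℕ.+ n ℕ.* c
      peel zero    f     f≤c = z≤n
      peel (suc n) f {c} f≤c = ℕₚ.+-monoʳ-≤ (f 0) (ℕₚ.≤-trans (∑ᴺ-mono n (λ i i<n → f≤c i (s<s i<n)))
        (ℕₚ.≤-trans (ℕₚ.≤-reflexive (∑ᴺ-const n c)) (ℕₚ.m≤n+m (n ℕ.* c) c)))
      bound : ∀ y → suc y ℕ.< p → ∣ correlation 0 (suc y) ∣ ℕ.≤ p ℕ.* p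
      bound y y<p = ℕₚ.≤-reflexive (trans (cong ∣_∣ (correlation-0 (suc y) y<p)) (ℤₚ.abs-* (+ p) (+ p)))
      collect : ∀ p b → p ℕ.* (p ℕ.* p) ℕ.+ p ℕ.* (p ℕ.* p) ℕ.+ p ℕ.* p ℕ.* p ℕ.* b ≡ p ℕ.* p ℕ.* p ℕ.* (2 ℕ.+ b)
      collect = ℕ-Ring.solve-∀
    row-bound x@(suc _) x<p = begin
      ℕΣ.∑ p (λ y → ∣ correlation x y ∣)                 ≡⟨ ℕΣ.∑-dilate x (coprime-p x x<p) (λ y → ∣ correlation x y ∣) ⟨
      ℕΣ.∑ p (λ h → ∣ correlation x (x ℕ.* h % p) ∣)     ≡⟨ ℕΣ.∑-cong p (λ h _ → cong ∣_∣ (correlation-dedekind x h x<p)) ⟩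
      ℕΣ.∑ p (λ h → ∣ dedekind h p ∣)                    ≤⟨ ∑-dedekind ⟩
      p ℕ.* p ℕ.* p ℕ.* (1 ℕ.+ 6 ℕ.* (L ℕ.* L))          ≤⟨ ℕₚ.*-monoʳ-≤ (p ℕ.* p ℕ.* p) (ℕₚ.n≤1+n _) ⟩
      p ℕ.* p ℕ.* p ℕ.* (2 ℕ.+ 6 ℕ.* (L ℕ.* L))          ∎
      where open ℕₚ.≤-Reasoning

  -- Cauchy-Schwarz, and sums over lists without repetition.

  2mn≤m²+n²-ordered : ∀ m n → m ℕ.≤ n → 2 ℕ.* (m ℕ.* n) ℕ.≤ m ℕ.* m ℕ.+ n ℕ.* n
  2mn≤m²+n²-ordered m n m≤n with ℕₚ.m≤n⇒∃[o]m+o≡n m≤n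
  ... | d , refl = ℕₚ.≤-trans (ℕₚ.m≤m+n _ (d ℕ.* d)) (ℕₚ.≤-reflexive (poly m d))
    where
    poly : ∀ m d → 2 ℕ.* (m ℕ.* (m ℕ.+ d)) ℕ.+ d ℕ.* d ≡ m ℕ.* m ℕ.+ (m ℕ.+ d) ℕ.* (m ℕ.+ d)
    poly = ℕ-Ring.solve-∀

  2mn≤m²+n² : ∀ m n → 2 ℕ.* (m ℕ.* n) ℕ.≤ m ℕ.* m ℕ.+ n ℕ.* n
  2mn≤m²+n² m n with ℕₚ.≤-total m n
  ... | inj₁ m≤n = 2mn≤m²+n²-ordered m n m≤n
  ... | inj₂ n≤m = subst₂ ℕ._≤_ (cong (2 ℕ.*_) (ℕₚ.*-comm n m)) (ℕₚ.+-comm (n ℕ.* n) (m ℕ.* m)) (2mn≤m²+n²-ordered n m n≤m)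

  -- Induction on `n`: the cross term `2 d s` is spread over the `n` remaining entries, each bounded
  -- by `2mn≤m²+n²`.
  cauchy-schwarz : ∀ n (f : ℕ → ℕ) → ℕΣ.∑ n f ℕ.* ℕΣ.∑ n f ℕ.≤ n ℕ.* ℕΣ.∑ n (λ i → f i ℕ.* f i)
  cauchy-schwarz zero    f = z≤n
  cauchy-schwarz (suc n) f = begin
    (d ℕ.+ s) ℕ.* (d ℕ.+ s)                             ≡⟨ expand d s ⟩
    d ℕ.* d ℕ.+ 2 ℕ.* d ℕ.* s ℕ.+ s ℕ.* s               ≤⟨ ℕₚ.+-mono-≤ (ℕₚ.+-monoʳ-≤ (d ℕ.* d) cross) (cauchy-schwarz n (f ∘ suc)) ⟩
    d ℕ.* d ℕ.+ (n ℕ.* (d ℕ.* d) ℕ.+ q) ℕ.+ n ℕ.* q     ≡⟨ collect (d ℕ.* d) n q ⟩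
    suc n ℕ.* (d ℕ.* d ℕ.+ q)                           ∎
    where
    open ℕₚ.≤-Reasoning
    d = f 0
    s = ℕΣ.∑ n (f ∘ suc)
    q = ℕΣ.∑ n (λ i → f (suc i) ℕ.* f (suc i))
    expand : ∀ d s → (d ℕ.+ s) ℕ.* (d ℕ.+ s) ≡ d ℕ.* d ℕ.+ 2 ℕ.* d ℕ.* s ℕ.+ s ℕ.* s
    expand = ℕ-Ring.solve-∀
    collect : ∀ e n q → e ℕ.+ (n ℕ.* e ℕ.+ q) ℕ.+ n ℕ.* q ≡ suc n ℕ.* (e ℕ.+ q)
    collect = ℕ-Ring.solve-∀
    cross : 2 ℕ.* d ℕ.* s ℕ.≤ n ℕ.* (d ℕ.* d) ℕ.+ q
    cross = begin
      2 ℕ.* d ℕ.* s                                            ≡⟨ ℕΣ.∑-*ˡ n (2 ℕ.* d) (f ∘ suc) ⟨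
      ℕΣ.∑ n (λ i → 2 ℕ.* d ℕ.* f (suc i))                     ≤⟨ ∑ᴺ-mono n (λ i _ → ℕₚ.≤-trans (ℕₚ.≤-reflexive (ℕₚ.*-assoc 2 d _)) (2mn≤m²+n² d (f (suc i)))) ⟩
      ℕΣ.∑ n (λ i → d ℕ.* d ℕ.+ f (suc i) ℕ.* f (suc i))       ≡⟨ ℕΣ.∑-+ n (λ _ → d ℕ.* d) (λ i → f (suc i) ℕ.* f (suc i)) ⟩
      ℕΣ.∑ n (λ _ → d ℕ.* d) ℕ.+ q                             ≡⟨ cong (ℕ._+ q) (∑ᴺ-const n (d ℕ.* d)) ⟩
      n ℕ.* (d ℕ.* d) ℕ.+ q                                    ∎

  +-∑ : ∀ n f → + ℕΣ.∑ n f ≡ ∑ n ((+_) ∘ f)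
  +-∑ zero    f = refl
  +-∑ (suc n) f = cong (λ z → + f 0 + z) (+-∑ n (f ∘ suc))

  ∣∑ᴸ∣≤∑ᴸ∣∣ : ∀ {A : Set} (xs : List A) f → ∣ ∑ᴸ xs f ∣ ℕ.≤ ℕΣ.∑ᴸ xs (∣_∣ ∘ f)
  ∣∑ᴸ∣≤∑ᴸ∣∣ []       f = z≤n
  ∣∑ᴸ∣≤∑ᴸ∣∣ (x ∷ xs) f = ℕₚ.≤-trans (ℤₚ.∣i+j∣≤∣i∣+∣j∣ (f x) (∑ᴸ xs f)) (ℕₚ.+-monoʳ-≤ ∣ f x ∣ (∣∑ᴸ∣≤∑ᴸ∣∣ xs f))

  ∑ᴸ≤length* : ∀ {A : Set} {P : A → Set} {f c} (xs : List A) → All P xs → (∀ x → P x → f x ℕ.≤ c) →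
               ℕΣ.∑ᴸ xs f ℕ.≤ length xs ℕ.* c
  ∑ᴸ≤length* []       []         f≤c = z≤n
  ∑ᴸ≤length* (x ∷ xs) (px ∷ pxs) f≤c = ℕₚ.+-mono-≤ (f≤c x px) (∑ᴸ≤length* xs pxs f≤c)

  erase : ℕ → (ℕ → ℕ) → ℕ → ℕ
  erase x f i = if does (i ℕ.≟ x) then 0 else f i

  ∑-erase : ∀ n x f → x ℕ.< n → ℕΣ.∑ n f ≡ f x ℕ.+ ℕΣ.∑ n (erase x f)
  ∑-erase (suc n) zero    f _         = refl
  ∑-erase (suc n) (suc x) f (s≤s x<n) =
    trans (cong (f 0 ℕ.+_) (∑-erase n x (f ∘ suc) x<n)) (poly (f 0) (f (suc x)) _)
    where
    poly : ∀ a b c → a ℕ.+ (b ℕ.+ c) ≡ b ℕ.+ (a ℕ.+ c)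
    poly = ℕ-Ring.solve-∀

  ∑ᴸ-erase : ∀ x f {ys} → All (x ≢_) ys → ℕΣ.∑ᴸ ys (erase x f) ≡ ℕΣ.∑ᴸ ys f
  ∑ᴸ-erase x f []               = refl
  ∑ᴸ-erase x f {y ∷ ys} (x≢y ∷ rest) =
    cong₂ ℕ._+_ (cong (λ b → if b then 0 else f y) (dec-false (y ℕ.≟ x) (x≢y ∘ sym))) (∑ᴸ-erase x f rest)

  -- Each entry claims its own term of the range sum. That term is erased before the remaining
  -- entries are treated, and uniqueness ensures that they do not see the erasure.
  ∑ᴸ-unique≤∑ : ∀ p f {xs} → Unique xs → All (ℕ._< p) xs → ℕΣ.∑ᴸ xs f ℕ.≤ ℕΣ.∑ p f
  ∑ᴸ-unique≤∑ p f []            []           = z≤n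
  ∑ᴸ-unique≤∑ p f {x ∷ xs} (x∉xs ∷ uniq) (x<p ∷ xs<p) = begin
    f x ℕ.+ ℕΣ.∑ᴸ xs f               ≡⟨ cong (f x ℕ.+_) (∑ᴸ-erase x f x∉xs) ⟨
    f x ℕ.+ ℕΣ.∑ᴸ xs (erase x f)     ≤⟨ ℕₚ.+-monoʳ-≤ (f x) (∑ᴸ-unique≤∑ p (erase x f) uniq xs<p) ⟩
    f x ℕ.+ ℕΣ.∑ p (erase x f)       ≡⟨ ∑-erase p x f x<p ⟨
    ℕΣ.∑ p f                         ∎
    where open ℕₚ.≤-Reasoning

  ∣i∣²≡i² : ∀ i → + (∣ i ∣ ℕ.* ∣ i ∣) ≡ i * i
  ∣i∣²≡i² (+ n)    = ℤₚ.pos-* n n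
  ∣i∣²≡i² -[1+ n ] = refl

  -- Discrepancy of the two bins.

  module Discrepancy (p : ℕ) .{{_ : NonZero p}} (pr : Prime p) (2<p : 2 ℕ.< p) where

    sign : ℕ → ℕ → ℤ
    sign a x = if inBin0 p a x then 1ℤ else - 1ℤ

    -- Doubling the residue `r` wraps around modulo `p` exactly in bin 1. Without wrapping the
    -- sawtooths combine to `p`, and the wrap subtracts `2 p`.
    sign-saw : ∀ a x → + p * sign a x ≡ saw p (2 ℕ.* a ℕ.* x) - + 2 * saw p (a ℕ.* x)
    sign-saw a x = subst (λ z → + p * sign a x ≡ + 2 * + z - + p - + 2 * saw p (a ℕ.* x)) (sym double) by-bin
      where
      r : ℕ
      r = a ℕ.* x % p
      double : 2 ℕ.* a ℕ.* x % p ≡ 2 ℕ.* r % p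
      double = trans (cong (_% p) (ℕₚ.*-assoc 2 a x)) (sym (*-%ʳ 2 (a ℕ.* x) p))
      by-bin : + p * sign a x ≡ + 2 * + (2 ℕ.* r % p) - + p - + 2 * (+ 2 * + r - + p)
      by-bin with (2 ℕ.* r) ℕ.<ᵇ p in eq
      ... | true  = trans (poly (+ r) (+ p)) (cong (λ z → + 2 * z - + p - + 2 * (+ 2 * + r - + p))
                      (trans (sym (ℤₚ.pos-* 2 r)) (cong +_ (sym (m<n⇒m%n≡m (ℕₚ.<ᵇ⇒< _ _ (subst T (sym eq) _)))))))
        where
        poly : ∀ r p → p * 1ℤ ≡ + 2 * (+ 2 * r) - p - + 2 * (+ 2 * r - p)
        poly = ℤ-Ring.solve-∀
      ... | false with ℕₚ.m≤n⇒∃[o]m+o≡n (ℕₚ.≮⇒≥ {2 ℕ.* r} {p} (λ l → subst T eq (ℕₚ.<⇒<ᵇ l)))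
      ...   | d , p+d≡2r = trans (poly (+ r) (+ p) (+ d) cast)
                  (cong (λ z → + 2 * + z - + p - + 2 * (+ 2 * + r - + p)) (sym 2r%p))
        where
        cast : + p + + d ≡ + 2 * + r
        cast = trans (cong +_ p+d≡2r) (ℤₚ.pos-* 2 r)
        poly : ∀ r p d → p + d ≡ + 2 * r → p * - 1ℤ ≡ + 2 * d - p - + 2 * (+ 2 * r - p)
        poly r p d e = trans (poly′ p d) (cong (λ z → + 2 * d - p - + 2 * (z - p)) e)
          where
          poly′ : ∀ p d → p * - 1ℤ ≡ + 2 * d - p - + 2 * (p + d - p)
          poly′ = ℤ-Ring.solve-∀
        d<p : d ℕ.< p
        d<p = ℕₚ.+-cancelˡ-< p d p (subst₂ ℕ._<_ (sym p+d≡2r) (cong (p ℕ.+_) (ℕₚ.+-identityʳ p)) (ℕₚ.*-monoʳ-< 2 (m%n<n (a ℕ.* x) p)))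
        2r%p : 2 ℕ.* r % p ≡ d
        2r%p = trans (cong (_% p) (trans (sym p+d≡2r) (ℕₚ.+-comm p d))) (trans ([m+n]%n≡m%n d p) (m<n⇒m%n≡m d<p))

    module _ (X : List ℕ) where

      disc : ℕ → ℤ
      disc a = ∑ᴸ X (sign a)

      saws : ℕ → ℤ
      saws a = ∑ᴸ X (λ x → saw p (a ℕ.* x))

      disc-saws : ∀ a → + p * disc a ≡ saws (2 ℕ.* a) - + 2 * saws a
      disc-saws a = go X
        where
        go : ∀ ys → + p * ∑ᴸ ys (sign a) ≡ ∑ᴸ ys (λ x → saw p (2 ℕ.* a ℕ.* x)) - + 2 * ∑ᴸ ys (λ x → saw p (a ℕ.* x))
        go []       = ℤₚ.*-zeroʳ (+ p)
        go (y ∷ ys) = trans (ℤₚ.*-distribˡ-+ (+ p) (sign a y) (∑ᴸ ys (sign a)))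
          (trans (cong₂ _+_ (sign-saw a y) (go ys))
                 (poly (saw p (2 ℕ.* a ℕ.* y)) (saw p (a ℕ.* y)) (∑ᴸ ys (λ x → saw p (2 ℕ.* a ℕ.* x))) (∑ᴸ ys (λ x → saw p (a ℕ.* x)))))
          where
          poly : ∀ s t u v → s - + 2 * t + (u - + 2 * v) ≡ s + u - + 2 * (t + v)
          poly = ℤ-Ring.solve-∀

      disc² saws² : ℕ → ℕ
      disc² a = ∣ disc a ∣ ℕ.* ∣ disc a ∣
      saws² a = ∣ saws a ∣ ℕ.* ∣ saws a ∣

      -- The triangle inequality gives `u + 2 v`, and its square is at most `2 u² + 8 v²`, since the
      -- cross term is bounded by the two squares.
      disc²≤saws² : ∀ a → p ℕ.* p ℕ.* disc² a ℕ.≤ 2 ℕ.* saws² (2 ℕ.* a) ℕ.+ 8 ℕ.* saws² a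
      disc²≤saws² a = begin
        p ℕ.* p ℕ.* disc² a
          ≡⟨ square p ∣ disc a ∣ ⟩
        (p ℕ.* ∣ disc a ∣) ℕ.* (p ℕ.* ∣ disc a ∣)
          ≤⟨ ℕₚ.*-mono-≤ triangle triangle ⟩
        (u ℕ.+ 2 ℕ.* v) ℕ.* (u ℕ.+ 2 ℕ.* v)
          ≡⟨ expand u v ⟩
        u ℕ.* u ℕ.+ 2 ℕ.* (u ℕ.* (2 ℕ.* v)) ℕ.+ 4 ℕ.* (v ℕ.* v)
          ≤⟨ ℕₚ.+-monoˡ-≤ _ (ℕₚ.+-monoʳ-≤ (u ℕ.* u) (2mn≤m²+n² u (2 ℕ.* v))) ⟩
        u ℕ.* u ℕ.+ (u ℕ.* u ℕ.+ 2 ℕ.* v ℕ.* (2 ℕ.* v)) ℕ.+ 4 ℕ.* (v ℕ.* v)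
          ≡⟨ collect u v ⟩
        2 ℕ.* (u ℕ.* u) ℕ.+ 8 ℕ.* (v ℕ.* v) ∎
        where
        open ℕₚ.≤-Reasoning
        u v : ℕ
        u = ∣ saws (2 ℕ.* a) ∣
        v = ∣ saws a ∣
        triangle : p ℕ.* ∣ disc a ∣ ℕ.≤ u ℕ.+ 2 ℕ.* v
        triangle = begin
          p ℕ.* ∣ disc a ∣                                ≡⟨ ℤₚ.abs-* (+ p) (disc a) ⟨
          ∣ + p * disc a ∣                                ≡⟨ cong ∣_∣ (disc-saws a) ⟩
          ∣ saws (2 ℕ.* a) - + 2 * saws a ∣               ≤⟨ ℤₚ.∣i-j∣≤∣i∣+∣j∣ (saws (2 ℕ.* a)) (+ 2 * saws a) ⟩
          u ℕ.+ ∣ + 2 * saws a ∣                          ≡⟨ cong (u ℕ.+_) (ℤₚ.abs-* (+ 2) (saws a)) ⟩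
          u ℕ.+ 2 ℕ.* v                                   ∎
        square : ∀ p d → p ℕ.* p ℕ.* (d ℕ.* d) ≡ (p ℕ.* d) ℕ.* (p ℕ.* d)
        square = ℕ-Ring.solve-∀
        expand : ∀ u v → (u ℕ.+ 2 ℕ.* v) ℕ.* (u ℕ.+ 2 ℕ.* v) ≡ u ℕ.* u ℕ.+ 2 ℕ.* (u ℕ.* (2 ℕ.* v)) ℕ.+ 4 ℕ.* (v ℕ.* v)
        expand = ℕ-Ring.solve-∀
        collect : ∀ u v → u ℕ.* u ℕ.+ (u ℕ.* u ℕ.+ 2 ℕ.* v ℕ.* (2 ℕ.* v)) ℕ.+ 4 ℕ.* (v ℕ.* v) ≡ 2 ℕ.* (u ℕ.* u) ℕ.+ 8 ℕ.* (v ℕ.* v)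
        collect = ℕ-Ring.solve-∀

      module _ (L : ℕ) (p≤2^L : p ℕ.≤ 2 ℕ.^ L) (uniq : Unique X) (X<p : All (ℕ._< p) X) where

        open RowSum p pr L p≤2^L

        B : ℕ
        B = p ℕ.* p ℕ.* p ℕ.* (2 ℕ.+ 6 ℕ.* (L ℕ.* L))

        -- Schur's test: the second moment is the sum of all correlations over pairs from `X`. As
        -- the entries are distinct residues, a row restricted to `X` is at most the full row, hence
        -- at most `B`.
        ∑-saws² : ℕΣ.∑ p saws² ℕ.≤ length X ℕ.* B
        ∑-saws² = begin
          ℕΣ.∑ p saws²                                       ≡⟨ cong ∣_∣ (trans (+-∑ p saws²) (trans (∑-cong p (λ a _ → ∣i∣²≡i² (saws a))) expand)) ⟩
          ∣ ∑ᴸ X (λ x → ∑ᴸ X (correlation x)) ∣              ≤⟨ ∣∑ᴸ∣≤∑ᴸ∣∣ X (λ x → ∑ᴸ X (correlation x)) ⟩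
          ℕΣ.∑ᴸ X (λ x → ∣ ∑ᴸ X (correlation x) ∣)           ≤⟨ ∑ᴸ≤length* X X<p row ⟩
          length X ℕ.* B                                     ∎
          where
          open ℕₚ.≤-Reasoning
          row : ∀ x → x ℕ.< p → ∣ ∑ᴸ X (correlation x) ∣ ℕ.≤ B
          row x x<p = ℕₚ.≤-trans (∣∑ᴸ∣≤∑ᴸ∣∣ X (correlation x))
            (ℕₚ.≤-trans (∑ᴸ-unique≤∑ p (∣_∣ ∘ correlation x) uniq X<p) (row-bound x x<p))
          expand : ∑ p (λ a → saws a * saws a) ≡ ∑ᴸ X (λ x → ∑ᴸ X (correlation x))
          expand = trans
            (∑-cong p (λ a _ → trans (sym (∑ᴸ-*ʳ X (saws a) (λ x → saw p (a ℕ.* x))))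
              (∑ᴸ-cong X (λ x → sym (∑ᴸ-*ˡ X (saw p (a ℕ.* x)) (λ y → saw p (a ℕ.* y)))))))
            (trans (∑-∑ᴸ-swap p X (λ a x → ∑ᴸ X (λ y → saw p (a ℕ.* x) * saw p (a ℕ.* y))))
                   (∑ᴸ-cong X (λ x → ∑-∑ᴸ-swap p X (λ a y → saw p (a ℕ.* x) * saw p (a ℕ.* y)))))

        -- Doubling permutes the residues since `p` is an odd prime, so both second moments are
        -- equal; `2 + 8 = 10` copies of `B` yield 20 and 60.
        ∑-disc² : ℕΣ.∑ p disc² ℕ.≤ length X ℕ.* p ℕ.* (20 ℕ.+ 60 ℕ.* (L ℕ.* L))
        ∑-disc² = ℕₚ.*-cancelˡ-≤ (p ℕ.* p) {{ℕₚ.m*n≢0 p p}} (begin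
          p ℕ.* p ℕ.* ℕΣ.∑ p disc²
            ≡⟨ ℕΣ.∑-*ˡ p (p ℕ.* p) disc² ⟨
          ℕΣ.∑ p (λ a → p ℕ.* p ℕ.* disc² a)
            ≤⟨ ∑ᴺ-mono p (λ a _ → disc²≤saws² a) ⟩
          ℕΣ.∑ p (λ a → 2 ℕ.* saws² (2 ℕ.* a) ℕ.+ 8 ℕ.* saws² a)
            ≡⟨ ℕΣ.∑-+ p (λ a → 2 ℕ.* saws² (2 ℕ.* a)) (λ a → 8 ℕ.* saws² a) ⟩
          ℕΣ.∑ p (λ a → 2 ℕ.* saws² (2 ℕ.* a)) ℕ.+ ℕΣ.∑ p (λ a → 8 ℕ.* saws² a)
            ≡⟨ cong₂ ℕ._+_ (trans (ℕΣ.∑-*ˡ p 2 (λ a → saws² (2 ℕ.* a))) (cong (2 ℕ.*_) doubled)) (ℕΣ.∑-*ˡ p 8 saws²) ⟩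
          2 ℕ.* ℕΣ.∑ p saws² ℕ.+ 8 ℕ.* ℕΣ.∑ p saws²
            ≤⟨ ℕₚ.+-mono-≤ (ℕₚ.*-monoʳ-≤ 2 ∑-saws²) (ℕₚ.*-monoʳ-≤ 8 ∑-saws²) ⟩
          2 ℕ.* (length X ℕ.* B) ℕ.+ 8 ℕ.* (length X ℕ.* B)
            ≡⟨ collect p (length X) L ⟩
          p ℕ.* p ℕ.* (length X ℕ.* p ℕ.* (20 ℕ.+ 60 ℕ.* (L ℕ.* L))) ∎)
          where
          open ℕₚ.≤-Reasoning
          saws²-% : ∀ a → saws² (a % p) ≡ saws² a
          saws²-% a = cong (λ z → ∣ z ∣ ℕ.* ∣ z ∣) (∑ᴸ-cong X (λ x → saw-cong (*-%ˡ a x p)))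
          doubled : ℕΣ.∑ p (λ a → saws² (2 ℕ.* a)) ≡ ℕΣ.∑ p saws²
          doubled = trans (ℕΣ.∑-cong p (λ a _ → sym (saws²-% (2 ℕ.* a)))) (ℕΣ.∑-dilate 2 (coprime-p 2 2<p) saws²)
          collect : ∀ p n L → let B = p ℕ.* p ℕ.* p ℕ.* (2 ℕ.+ 6 ℕ.* (L ℕ.* L)) in
            2 ℕ.* (n ℕ.* B) ℕ.+ 8 ℕ.* (n ℕ.* B) ≡ p ℕ.* p ℕ.* (n ℕ.* p ℕ.* (20 ℕ.+ 60 ℕ.* (L ℕ.* L)))
          collect = ℕ-Ring.solve-∀

      loads-length : ∀ a → load0 p a X ℕ.+ load1 p a X ≡ length X
      loads-length a = go X
        where
        go : ∀ ys → load0 p a ys ℕ.+ load1 p a ys ≡ length ys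
        go []       = refl
        go (y ∷ ys) with inBin0 p a y
        ... | true  = cong suc (go ys)
        ... | false = trans (ℕₚ.+-suc _ _) (cong suc (go ys))

      loads-disc : ∀ a → + load0 p a X - + load1 p a X ≡ disc a
      loads-disc a = go X
        where
        gain : ∀ s t → 1ℤ + s - t ≡ 1ℤ + (s - t)
        gain = ℤ-Ring.solve-∀
        lose : ∀ s t → s - (1ℤ + t) ≡ - 1ℤ + (s - t)
        lose = ℤ-Ring.solve-∀
        go : ∀ ys → + load0 p a ys - + load1 p a ys ≡ ∑ᴸ ys (sign a)
        go []       = refl
        go (y ∷ ys) with inBin0 p a y
        ... | true  = trans (gain (+ load0 p a ys) (+ load1 p a ys)) (cong (λ z → 1ℤ + z) (go ys))
        ... | false = trans (lose (+ load0 p a ys) (+ load1 p a ys)) (cong (λ z → - 1ℤ + z) (go ys))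

      -- Twice a maximum is the sum plus the distance; the loads add up to `length X` and differ by
      -- `disc a`.
      2*maxload : ∀ a → 2 ℕ.* maxload p a X ≡ length X ℕ.+ ∣ disc a ∣
      2*maxload a = trans (2*⊔ (load0 p a X) (load1 p a X)) (cong₂ ℕ._+_ (loads-length a) (cong ∣_∣ (loads-disc a)))
        where
        2*⊔ : ∀ m n → 2 ℕ.* (m ⊔ n) ≡ m ℕ.+ n ℕ.+ ∣ + m - + n ∣
        2*⊔ m n with ℕₚ.≤-total m n
        ... | inj₁ m≤n with ℕₚ.m≤n⇒∃[o]m+o≡n m≤n
        ...   | d , refl = trans (cong (2 ℕ.*_) (ℕₚ.m≤n⇒m⊔n≡n m≤n)) (trans (poly m d) (cong (m ℕ.+ (m ℕ.+ d) ℕ.+_)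
                  (sym (trans (cong ∣_∣ (difference (+ m) (+ d))) (ℤₚ.∣-i∣≡∣i∣ (+ d))))))
          where
          poly : ∀ m d → 2 ℕ.* (m ℕ.+ d) ≡ m ℕ.+ (m ℕ.+ d) ℕ.+ d
          poly = ℕ-Ring.solve-∀
          difference : ∀ m d → m - (m + d) ≡ - d
          difference = ℤ-Ring.solve-∀
        2*⊔ m n | inj₂ n≤m with ℕₚ.m≤n⇒∃[o]m+o≡n n≤m
        ...   | d , refl = trans (cong (2 ℕ.*_) (ℕₚ.m≥n⇒m⊔n≡m n≤m)) (trans (poly n d) (cong (n ℕ.+ d ℕ.+ n ℕ.+_)
                  (sym (cong ∣_∣ (difference (+ n) (+ d))))))
          where
          poly : ∀ m d → 2 ℕ.* (m ℕ.+ d) ≡ m ℕ.+ d ℕ.+ m ℕ.+ d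
          poly = ℕ-Ring.solve-∀
          difference : ∀ m d → m + d - m ≡ d
          difference = ℤ-Ring.solve-∀

      -- Summing `2*maxload` over the multipliers shows that the truncated subtraction is exact.
      excess≡∑∣disc∣ : 2 ℕ.* totalMaxload p X ℕ.∸ (p ℕ.∸ 1) ℕ.* length X ≡ ℕΣ.∑ (p ℕ.∸ 1) (λ i → ∣ disc (suc i) ∣)
      excess≡∑∣disc∣ = trans (cong (ℕ._∸ (p ℕ.∸ 1) ℕ.* length X) (total (p ℕ.∸ 1) suc)) (ℕₚ.m+n∸m≡n ((p ℕ.∸ 1) ℕ.* length X) _)
        where
        -- The enumeration `s` of the multipliers is general so that the induction can shift it.
        total : ∀ m (s : ℕ → ℕ) → 2 ℕ.* sumᴺ (applyUpTo (λ i → maxload p (s i) X) m) ≡ m ℕ.* length X ℕ.+ ℕΣ.∑ m (λ i → ∣ disc (s i) ∣)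
        total zero    s = refl
        total (suc m) s = begin
          2 ℕ.* (maxload p (s 0) X ℕ.+ rest)
            ≡⟨ ℕₚ.*-distribˡ-+ 2 (maxload p (s 0) X) rest ⟩
          2 ℕ.* maxload p (s 0) X ℕ.+ 2 ℕ.* rest
            ≡⟨ cong₂ ℕ._+_ (2*maxload (s 0)) (total m (s ∘ suc)) ⟩
          length X ℕ.+ ∣ disc (s 0) ∣ ℕ.+ (m ℕ.* length X ℕ.+ ℕΣ.∑ m (λ i → ∣ disc (s (suc i)) ∣))
            ≡⟨ poly (length X) ∣ disc (s 0) ∣ (m ℕ.* length X) _ ⟩
          suc m ℕ.* length X ℕ.+ ℕΣ.∑ (suc m) (λ i → ∣ disc (s i) ∣) ∎
          where
          open ≡-Reasoning
          rest = sumᴺ (applyUpTo (λ i → maxload p (s (suc i)) X) m)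
          poly : ∀ a b c d → a ℕ.+ b ℕ.+ (c ℕ.+ d) ≡ a ℕ.+ c ℕ.+ (b ℕ.+ d)
          poly = ℕ-Ring.solve-∀

      excess²≤∑disc² : let excess = 2 ℕ.* totalMaxload p X ℕ.∸ (p ℕ.∸ 1) ℕ.* length X in
        excess ℕ.* excess ℕ.≤ (p ℕ.∸ 1) ℕ.* ℕΣ.∑ p disc²
      excess²≤∑disc² = begin
        _
          ≡⟨ cong₂ ℕ._*_ excess≡∑∣disc∣ excess≡∑∣disc∣ ⟩
        ℕΣ.∑ (p ℕ.∸ 1) (λ i → ∣ disc (suc i) ∣) ℕ.* ℕΣ.∑ (p ℕ.∸ 1) (λ i → ∣ disc (suc i) ∣)
          ≤⟨ cauchy-schwarz (p ℕ.∸ 1) (λ i → ∣ disc (suc i) ∣) ⟩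
        (p ℕ.∸ 1) ℕ.* ℕΣ.∑ (p ℕ.∸ 1) (disc² ∘ suc)
          -- The multiplier 0, which the hash family excludes, is added to obtain a full residue
          -- system.
          ≤⟨ ℕₚ.*-monoʳ-≤ (p ℕ.∸ 1) (ℕₚ.m≤n+m _ (disc² 0)) ⟩
        (p ℕ.∸ 1) ℕ.* ℕΣ.∑ (suc (p ℕ.∸ 1)) disc²
          ≡⟨ cong (λ z → (p ℕ.∸ 1) ℕ.* ℕΣ.∑ z disc²) (ℕₚ.suc-pred p) ⟩
        (p ℕ.∸ 1) ℕ.* ℕΣ.∑ p disc² ∎
        where open ℕₚ.≤-Reasoning

-- The bound in terms of `n`, with explicit constants.

open Correlations
open import Data.Nat using (_+_; _*_; _∸_; _^_; _≤_; _<_)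

-- The expected maxload minus `n / 2` is `excess` divided by `2 (p - 1)`. The bound of order `√n`
-- times a power of the logarithm is squared, which keeps it within the natural numbers.
mainTheorem5 : (C : ℕ) → ∃[ K ] ∃[ E ] ∃[ N₀ ] ((n p : ℕ) .{{_ : NonZero p}} →
    N₀ ≤ n → Prime p → n ^ 6 ≤ p → p ≤ n ^ C →
    (X : List ℕ) → Unique X → All (_< p) X → length X ≡ n →
    let excess = 2 * totalMaxload p X ∸ (p ∸ 1) * n in
    excess * excess ≤ K * ((p ∸ 1) * (p ∸ 1)) * n * (⌊log₂ n ⌋ ^ E))
-- With `l = ⌊log₂ n⌋`, the bound `L ≤ 2 l C` turns `20 + 60 L²` into at most `(20 + 240 C²) l²`,
-- and `p ≤ 2 (p - 1)` doubles this. The threshold 2 gives `1 ≤ l`.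
mainTheorem5 C = 40 + 480 * (C * C) , 2 , 2 , bound
  where
  open ℕₚ.≤-Reasoning
  bound : (n p : ℕ) .{{_ : NonZero p}} →
    2 ≤ n → Prime p → n ^ 6 ≤ p → p ≤ n ^ C →
    (X : List ℕ) → Unique X → All (_< p) X → length X ≡ n →
    let excess = 2 * totalMaxload p X ∸ (p ∸ 1) * n in
    excess * excess ≤ (40 + 480 * (C * C)) * ((p ∸ 1) * (p ∸ 1)) * n * (⌊log₂ n ⌋ ^ 2)
  bound n p 2≤n pr n⁶≤p p≤n^C X uniq X<p refl = begin
    _
      ≤⟨ excess²≤∑disc² X ⟩
    (p ∸ 1) * ℕΣ.∑ p (disc² X)
      ≤⟨ ℕₚ.*-monoʳ-≤ (p ∸ 1) (∑-disc² X L p≤2^L uniq X<p) ⟩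
    (p ∸ 1) * (n * p * (20 + 60 * (L * L)))
      ≤⟨ ℕₚ.*-monoʳ-≤ (p ∸ 1) (ℕₚ.*-mono-≤ (ℕₚ.*-monoʳ-≤ n p≤) (ℕₚ.+-mono-≤ (ℕₚ.*-monoʳ-≤ 20 (ℕₚ.*-mono-≤ 1≤l 1≤l)) (ℕₚ.*-monoʳ-≤ 60 (ℕₚ.*-mono-≤ L≤ L≤)))) ⟩
    (p ∸ 1) * (n * (2 * (p ∸ 1)) * (20 * (l * l) + 60 * (2 * l * C * (2 * l * C))))
      ≡⟨ collect (p ∸ 1) n l C ⟩
    (40 + 480 * (C * C)) * ((p ∸ 1) * (p ∸ 1)) * n * (l ^ 2) ∎
    where
    l L : ℕ
    l = ⌊log₂ n ⌋
    L = suc l * C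
    1≤l : 1 ≤ l
    1≤l = ⌊log₂⌋-mono-≤ 2≤n
    L≤ : L ≤ 2 * l * C
    L≤ = ℕₚ.*-monoˡ-≤ C (ℕₚ.≤-trans (ℕₚ.+-monoˡ-≤ l 1≤l) (ℕₚ.≤-reflexive (cong (λ z → l + z) (sym (ℕₚ.+-identityʳ l)))))
    p≤2^L : p ≤ 2 ^ L
    p≤2^L = begin
      p                    ≤⟨ p≤n^C ⟩
      n ^ C                ≤⟨ ℕₚ.^-monoˡ-≤ C (ℕₚ.<⇒≤ (n<2^[1+log₂n] n)) ⟩
      (2 ^ suc l) ^ C      ≡⟨ ℕₚ.^-*-assoc 2 (suc l) C ⟩
      2 ^ L                ∎
    2<p : 2 < p
    2<p = ℕₚ.≤-trans (s≤s (s≤s (s≤s z≤n))) (ℕₚ.≤-trans (ℕₚ.^-monoˡ-≤ 6 2≤n) n⁶≤p)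
    p≤ : p ≤ 2 * (p ∸ 1)
    p≤ = begin
      p                      ≡⟨ ℕₚ.suc-pred p ⟨
      suc (p ∸ 1)            ≤⟨ ℕₚ.+-monoˡ-≤ (p ∸ 1) (ℕₚ.m<n⇒0<n∸m (ℕₚ.<⇒≤ 2<p)) ⟩
      (p ∸ 1) + (p ∸ 1)    ≡⟨ cong (λ z → (p ∸ 1) + z) (ℕₚ.+-identityʳ (p ∸ 1)) ⟨
      2 * (p ∸ 1)          ∎
    open Discrepancy p pr 2<p
    collect : ∀ m n l C → m * (n * (2 * m) * (20 * (l * l) + 60 * (2 * l * C * (2 * l * C))))
      ≡ (40 + 480 * (C * C)) * (m * m) * n * (l * (l * 1))
    collect = ℕ-Ring.solve-∀
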